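{- The following hold. (1) $A(n) \equiv 5^n \pmod 8$ for all integers $n \geq 0$, and $A(n) \equiv 5^{n + 1} \pmod 8$ for all integers $n \leq -1$. (2) $A(d + 3 n) \equiv A(d) A(n) \pmod 9$ for all $d \in \{0, 1, 2\}$ and all $n \in \mathbb{Z}$. (3) For all primes $p \geq 5$ and all $n \in \mathbb{Z}$, $A(p n) \equiv A(n) \equiv A(p n + p - 1) \pmod{p^3}$.
   Context: $A(z)$ denotes the Ap\'ery function, the entire function \[ A(z) = \sum_{k \geq 0} \frac{\Gamma(z + k + 1)^2}{\Gamma(z - k + 1)^2\, \Gamma(k + 1)^4} = \sum_{k\ge 0}\frac{(-z)_k^2\,(z+1)_k^2}{k!^4}, \] where $(x)_k = x(x+1)\cdots(x+k-1)$; each summand is a polynomial in $z$. For non-negative integers $n$, $A(n)=\sum_{k\ge0}\binom{n}{k}^2\binom{n+k}{k}^2$; for negative integers $n$, $A(n)$ is the value of this entire function, which satisfies $A(n)=A(-1-n)$ and hence is an integer. For $n+1\le 0$, $5^{n+1}$ is a rational number with odd denominator and is interpreted modulo $8$ accordingly. -}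

module Defs where

open import Data.Nat as ℕ using (ℕ; zero; suc)
open import Data.Nat.Combinatorics using (_C_)
open import Data.List using (List; map; upTo)
open import Data.Nat.ListAction using (sum)
open import Data.Integer as ℤ using (ℤ; +_; -[1+_]; _-_)
open import Data.Integer.Divisibility using (_∣_)

apéryℕ : ℕ → ℕ
apéryℕ n = sum (map (λ k → (n C k) ℕ.^ 2 ℕ.* ((n ℕ.+ k) C k) ℕ.^ 2) (upTo (suc n)))

-- The Apéry function at integers: A(n) for n ≥ 0, and A(-1-m) = A(m)
-- (the entire function's value; the summands (-z)_k^2 (z+1)_k^2 / k!^4 at
-- z = -1-m coincide with those at z = m).
A : ℤ → ℤ
A (+ n)      = + apéryℕ n
A -[1+ m ]   = + apéryℕ m

infix 4 _≡_[mod_]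
_≡_[mod_] : ℤ → ℤ → ℕ → Set
a ≡ b [mod m ] = (+ m) ∣ (a - b)

{-# OPTIONS --safe #-}
-- Put t n k = C(n,k) C(n+k,k), so that A(n) = ∑ t² and (k+1)² t(k+1) = (n(n+1) - k(k+1)) t(k).
-- The recurrence involves n through n(n+1) only, so it makes sense for n ∈ ℤ and is
-- invariant under n ↦ -1-n; hence A(pn+p-1) ≡ A(n) is A(pz) ≡ A(z) at z = -1-n.
--
-- Modulo p³: for z ∈ ℤ, running the recurrence through a block of p indices gives
-- t(pz, pj) ∏ F(l)² = t(z, j) ∏ F(z-l-1) F(z+l), products over l < j, with F(x) = ∏_{0<r<p} (px + r), and
-- F(x)² = ∏ (r(p-r) + p²x(x+1)) is independent of x modulo p³ because ∑ r⁻² ≡ 0 modulo p.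
-- For k = pj + r with 0 < r < p the term t is divisible by p and r² t² is independent of r
-- modulo p³, so these terms cancel, again by ∑ r⁻² ≡ 0.
--
-- Modulo 9: the same argument settles 3n and 3n+2. For 3n+1, a block of three terms is
-- (5 + 3j) t(3j)² and t(3j)² ≡ (1 + 3j) t(n,j)², whence the factor 5.
--
-- Modulo 8: t is even for k ≥ 1, so t² ≡ 2 (-1)^k t, and ∑ (-1)^k t = (-1)^n.
module Submission where

open import Defs
open import Data.Nat as ℕ using (ℕ; zero; suc; _≥_; s≤s; z≤n; NonZero)
import Data.Nat.Properties as ℕₚ
open import Data.Nat.Combinatorics using (_C_; nCk+nC[k+1]≡[n+1]C[k+1]; k>n⇒nCk≡0)
open import Data.Nat.Coprimality using (prime⇒coprime; coprime-Bézout)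
open import Data.Nat.Divisibility using () renaming (divides to ℕ-divides)
open import Data.Nat.GCD using (module Bézout)
open import Data.Nat.Primality using (Prime; prime⇒irreducible)
import Data.Nat.Tactic.RingSolver as ℕ-Solver
open import Data.Nat.ListAction using (sum)
open import Data.List using (applyUpTo)
open import Data.List.Properties using (map-upTo)
open import Data.Integer as ℤ using (ℤ; +_; -[1+_]; _+_; _*_; _^_; _-_; -_; 0ℤ; 1ℤ)
import Data.Integer.Properties as ℤₚ
open import Data.Integer.Divisibility.Signed using (divides; ∣⇒∣ᵤ)
open import Data.Integer.Tactic.RingSolver using (solve-∀)
open import Data.Product using (_×_; _,_; ∃)
open import Data.Sum using (_⊎_; inj₁; inj₂)
open import Data.Empty using (⊥-elim)
open import Function using (_∘_)
open import Relation.Binary.Bundles using (Setoid)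
open import Relation.Binary.PropositionalEquality
  using (_≡_; refl; sym; trans; cong; cong₂; subst; subst₂; module ≡-Reasoning)
import Relation.Binary.Reasoning.Setoid as SetoidReasoning

-- Congruences

infix 4 _≈_[_]
infix 3 _by_
-- The equation is solved for `a`, so matching a witness with `refl` substitutes for `a` and turns
-- each closure property into one polynomial identity for the ring solver.
record _≈_[_] (a b m : ℤ) : Set where
  constructor _by_
  field
    quotient : ℤ
    equality : a ≡ b + quotient * m

module _ {m : ℤ} where

  ≈-reflexive : ∀ {a b} → a ≡ b → a ≈ b [ m ]
  ≈-reflexive {a} refl = 0ℤ by lemma a m
    where
    lemma : ∀ a m → a ≡ a + 0ℤ * m
    lemma = solve-∀

  ≈-refl : ∀ {a} → a ≈ a [ m ]
  ≈-refl = ≈-reflexive refl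

  ≈-sym : ∀ {a b} → a ≈ b [ m ] → b ≈ a [ m ]
  ≈-sym {b = b} (c by refl) = (- c) by lemma b c m
    where
    lemma : ∀ b c m → b ≡ b + c * m + - c * m
    lemma = solve-∀

  ≈-trans : ∀ {a b c} → a ≈ b [ m ] → b ≈ c [ m ] → a ≈ c [ m ]
  ≈-trans {c = c} (k by refl) (l by refl) = (k + l) by lemma c k l m
    where
    lemma : ∀ c k l m → c + l * m + k * m ≡ c + (k + l) * m
    lemma = solve-∀

  +-cong : ∀ {a b c d} → a ≈ b [ m ] → c ≈ d [ m ] → a + c ≈ b + d [ m ]
  +-cong {b = b} {d = d} (k by refl) (l by refl) = (k + l) by lemma b d k l m
    where
    lemma : ∀ b d k l m → (b + k * m) + (d + l * m) ≡ b + d + (k + l) * m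
    lemma = solve-∀

  *-cong : ∀ {a b c d} → a ≈ b [ m ] → c ≈ d [ m ] → a * c ≈ b * d [ m ]
  *-cong {b = b} {d = d} (k by refl) (l by refl) =
    (k * d + b * l + k * l * m) by lemma b d k l m
    where
    lemma : ∀ b d k l m → (b + k * m) * (d + l * m) ≡ b * d + (k * d + b * l + k * l * m) * m
    lemma = solve-∀

  +-≈0ʳ : ∀ a {b} → b ≈ 0ℤ [ m ] → a + b ≈ a [ m ]
  +-≈0ʳ a b≈0 = ≈-trans (+-cong (≈-refl {a}) b≈0) (≈-reflexive (ℤₚ.+-identityʳ a))

  *-congˡ : ∀ a {b c} → b ≈ c [ m ] → a * b ≈ a * c [ m ]
  *-congˡ a = *-cong (≈-refl {a})

  *-congʳ : ∀ c {a b} → a ≈ b [ m ] → a * c ≈ b * c [ m ]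
  *-congʳ c a≈b = *-cong a≈b (≈-refl {c})

  sq-cong : ∀ {a b} → a ≈ b [ m ] → a * a ≈ b * b [ m ]
  sq-cong a≈b = *-cong a≈b a≈b

  *-zeroˡ-≈ : ∀ b {a} → a ≈ 0ℤ [ m ] → a * b ≈ 0ℤ [ m ]
  *-zeroˡ-≈ b a≈0 = ≈-trans (*-congʳ b a≈0) (≈-reflexive (ℤₚ.*-zeroˡ b))

  *-zeroʳ-≈ : ∀ a {b} → b ≈ 0ℤ [ m ] → a * b ≈ 0ℤ [ m ]
  *-zeroʳ-≈ a b≈0 = ≈-trans (*-congˡ a b≈0) (≈-reflexive (ℤₚ.*-zeroʳ a))

  multiple : ∀ k → m * k ≈ 0ℤ [ m ]
  multiple k = k by lemma m k
    where
    lemma : ∀ m k → m * k ≡ 0ℤ + k * m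
    lemma = solve-∀

  modulus≈0 : m ≈ 0ℤ [ m ]
  modulus≈0 = ≈-trans (≈-reflexive (sym (ℤₚ.*-identityʳ m))) (multiple 1ℤ)

≈-setoid : ℤ → Setoid _ _
≈-setoid m = record
  { Carrier       = ℤ
  ; _≈_           = _≈_[ m ]
  ; isEquivalence = record { refl = ≈-refl ; sym = ≈-sym ; trans = ≈-trans }
  }

module ≈-Reasoning (m : ℤ) = SetoidReasoning (≈-setoid m)

≈0-*-≈0 : ∀ {m n a b} → a ≈ 0ℤ [ m ] → b ≈ 0ℤ [ n ] → a * b ≈ 0ℤ [ m * n ]
≈0-*-≈0 {m} {n} (k by refl) (l by refl) = (k * l) by lemma k l m n
  where
  lemma : ∀ k l m n → (0ℤ + k * m) * (0ℤ + l * n) ≡ 0ℤ + (k * l) * (m * n)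
  lemma = solve-∀

≈⇒≡[mod] : ∀ m {a b} → a ≈ b [ + m ] → a ≡ b [mod m ]
≈⇒≡[mod] m {b = b} (k by refl) = ∣⇒∣ᵤ (divides k (lemma b k (+ m)))
  where
  lemma : ∀ b k m → b + k * m - b ≡ k * m
  lemma = solve-∀

-- Units modulo m

record Unit (m a : ℤ) : Set where
  constructor _,_
  field
    inverse   : ℤ
    *-inverse : a * inverse ≈ 1ℤ [ m ]

Unit-1 : ∀ {m} → Unit m 1ℤ
Unit-1 = 1ℤ , ≈-refl

Unit-* : ∀ {m a b} → Unit m a → Unit m b → Unit m (a * b)
Unit-* {a = a} {b} (v , av) (w , bw) =
  v * w , ≈-trans (≈-reflexive (lemma a b v w)) (*-cong av bw)
  where
  lemma : ∀ a b v w → a * b * (v * w) ≡ (a * v) * (b * w)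
  lemma = solve-∀

Unit-resp : ∀ {m a b} → a ≈ b [ m ] → Unit m b → Unit m a
Unit-resp a≈b (v , bv) = v , ≈-trans (*-congʳ v a≈b) bv

-- If a v = 1 + c m and a w = 1 + d n then (1 - a v)(1 - a w) ≡ 0 modulo m n.
Unit-mod-* : ∀ {m n a} → Unit m a → Unit n a → Unit (m * n) a
Unit-mod-* {m} {n} {a} (v , (c by p)) (w , (d by q)) =
  v + w - a * v * w , ((- (c * d)) by (begin
    a * (v + w - a * v * w)                       ≡⟨ lemma₁ a v w ⟩
    1ℤ - (a * v - 1ℤ) * (a * w - 1ℤ)              ≡⟨ cong₂ (λ x y → 1ℤ - (x - 1ℤ) * (y - 1ℤ)) p q ⟩
    1ℤ - (1ℤ + c * m - 1ℤ) * (1ℤ + d * n - 1ℤ)    ≡⟨ lemma₂ c d m n ⟩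
    1ℤ + - (c * d) * (m * n)                      ∎))
  where
  open ≡-Reasoning
  lemma₁ : ∀ a v w → a * (v + w - a * v * w) ≡ 1ℤ - (a * v - 1ℤ) * (a * w - 1ℤ)
  lemma₁ = solve-∀
  lemma₂ : ∀ c d m n → 1ℤ - (1ℤ + c * m - 1ℤ) * (1ℤ + d * n - 1ℤ) ≡ 1ℤ + - (c * d) * (m * n)
  lemma₂ = solve-∀

Unit-cancel : ∀ {m a x y} → Unit m a → a * x ≈ a * y [ m ] → x ≈ y [ m ]
Unit-cancel {m} {a} {x} {y} (v , av) ax≈ay = begin
  x             ≡⟨ ℤₚ.*-identityˡ x ⟨
  1ℤ * x        ≈⟨ *-congʳ x av ⟨
  a * v * x     ≡⟨ lemma a v x ⟩
  v * (a * x)   ≈⟨ *-congˡ v ax≈ay ⟩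
  v * (a * y)   ≡⟨ lemma a v y ⟨
  a * v * y     ≈⟨ *-congʳ y av ⟩
  1ℤ * y        ≡⟨ ℤₚ.*-identityˡ y ⟩
  y             ∎
  where
  open ≈-Reasoning m
  lemma : ∀ a v x → a * v * x ≡ v * (a * x)
  lemma = solve-∀

Unit-cancel-0 : ∀ {m a x} → Unit m a → a * x ≈ 0ℤ [ m ] → x ≈ 0ℤ [ m ]
Unit-cancel-0 {a = a} u ax≈0 = Unit-cancel u (≈-trans ax≈0 (≈-reflexive (sym (ℤₚ.*-zeroʳ a))))

prime⇒Unit : ∀ {p} → Prime p → ∀ a .{{_ : NonZero a}} → a ℕ.< p → Unit (+ p) (+ a)
prime⇒Unit {p} p-prime a a<p with coprime-Bézout (prime⇒coprime p-prime a<p)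
-- Bézout's identity over ℕ has two shapes. Here it reads 1 + y a = x p, so the inverse of a is -y;
-- in the other shape it is y.
... | Bézout.+- x y eq = - + y , ((- + x) by (begin
  + a * - + y                ≡⟨ lemma₁ (+ a) (+ y) ⟩
  1ℤ - (1ℤ + + y * + a)      ≡⟨ cong (λ w → 1ℤ - w) (trans (cong (λ w → 1ℤ + w) (sym (ℤₚ.pos-* y a))) (trans (cong +_ eq) (ℤₚ.pos-* x p))) ⟩
  1ℤ - + x * + p             ≡⟨ lemma₂ (+ x) (+ p) ⟩
  1ℤ + - + x * + p           ∎))
  where
  open ≡-Reasoning
  lemma₁ : ∀ a y → a * - y ≡ 1ℤ - (1ℤ + y * a)
  lemma₁ = solve-∀
  lemma₂ : ∀ x p → 1ℤ - x * p ≡ 1ℤ + - x * p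
  lemma₂ = solve-∀
... | Bézout.-+ x y eq = + y , (+ x by (begin
  + a * + y         ≡⟨ ℤₚ.*-comm (+ a) (+ y) ⟩
  + y * + a         ≡⟨ ℤₚ.pos-* y a ⟨
  + (y ℕ.* a)       ≡⟨ cong +_ eq ⟨
  1ℤ + + (x ℕ.* p)  ≡⟨ cong (λ w → 1ℤ + w) (ℤₚ.pos-* x p) ⟩
  1ℤ + + x * + p    ∎))
  where open ≡-Reasoning

-- Finite sums and products

∑ : ℕ → (ℕ → ℤ) → ℤ
∑ zero    f = 0ℤ
∑ (suc n) f = f 0 + ∑ n (f ∘ suc)

∏ : ℕ → (ℕ → ℤ) → ℤ
∏ zero    f = 1ℤ
∏ (suc n) f = f 0 * ∏ n (f ∘ suc)

∑-snoc : ∀ n f → ∑ (suc n) f ≡ ∑ n f + f n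
∑-snoc zero    f = ℤₚ.+-comm (f 0) 0ℤ
∑-snoc (suc n) f =
  trans (cong (λ w → f 0 + w) (∑-snoc n (f ∘ suc))) (sym (ℤₚ.+-assoc (f 0) (∑ n (f ∘ suc)) (f (suc n))))

∏-snoc : ∀ n f → ∏ (suc n) f ≡ ∏ n f * f n
∏-snoc zero    f = ℤₚ.*-comm (f 0) 1ℤ
∏-snoc (suc n) f =
  trans (cong (f 0 *_) (∏-snoc n (f ∘ suc))) (sym (ℤₚ.*-assoc (f 0) (∏ n (f ∘ suc)) (f (suc n))))

∑-cong : ∀ n {f g} → (∀ i → f i ≡ g i) → ∑ n f ≡ ∑ n g
∑-cong zero    f≡g = refl
∑-cong (suc n) f≡g = cong₂ _+_ (f≡g 0) (∑-cong n (f≡g ∘ suc))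

∑-≈ : ∀ {m} n {f g} → (∀ i → i ℕ.< n → f i ≈ g i [ m ]) → ∑ n f ≈ ∑ n g [ m ]
∑-≈ zero    f≈g = ≈-refl
∑-≈ (suc n) f≈g = +-cong (f≈g 0 (s≤s z≤n)) (∑-≈ n λ i i<n → f≈g (suc i) (s≤s i<n))

∏-cong : ∀ n {f g} → (∀ i → f i ≡ g i) → ∏ n f ≡ ∏ n g
∏-cong zero    f≡g = refl
∏-cong (suc n) f≡g = cong₂ _*_ (f≡g 0) (∏-cong n (f≡g ∘ suc))

∏-≈ : ∀ {m} n {f g} → (∀ i → i ℕ.< n → f i ≈ g i [ m ]) → ∏ n f ≈ ∏ n g [ m ]
∏-≈ zero    f≈g = ≈-refl
∏-≈ (suc n) f≈g = *-cong (f≈g 0 (s≤s z≤n)) (∏-≈ n λ i i<n → f≈g (suc i) (s≤s i<n))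

∑-zero : ∀ n → ∑ n (λ _ → 0ℤ) ≡ 0ℤ
∑-zero zero    = refl
∑-zero (suc n) = trans (ℤₚ.+-identityˡ _) (∑-zero n)

∑-+ : ∀ n f g → ∑ n (λ i → f i + g i) ≡ ∑ n f + ∑ n g
∑-+ zero    f g = refl
∑-+ (suc n) f g = trans (cong (λ w → f 0 + g 0 + w) (∑-+ n (f ∘ suc) (g ∘ suc)))
                        (lemma (f 0) (g 0) (∑ n (f ∘ suc)) (∑ n (g ∘ suc)))
  where
  lemma : ∀ a b c d → a + b + (c + d) ≡ (a + c) + (b + d)
  lemma = solve-∀

∏-* : ∀ n f g → ∏ n (λ i → f i * g i) ≡ ∏ n f * ∏ n g
∏-* zero    f g = refl
∏-* (suc n) f g = trans (cong (f 0 * g 0 *_) (∏-* n (f ∘ suc) (g ∘ suc)))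
                        (lemma (f 0) (g 0) (∏ n (f ∘ suc)) (∏ n (g ∘ suc)))
  where
  lemma : ∀ a b c d → a * b * (c * d) ≡ (a * c) * (b * d)
  lemma = solve-∀

∑-*ˡ : ∀ c n f → ∑ n (λ i → c * f i) ≡ c * ∑ n f
∑-*ˡ c zero    f = sym (ℤₚ.*-zeroʳ c)
∑-*ˡ c (suc n) f = trans (cong (λ w → c * f 0 + w) (∑-*ˡ c n (f ∘ suc))) (sym (ℤₚ.*-distribˡ-+ c (f 0) _))

∑-split : ∀ m n f → ∑ (m ℕ.+ n) f ≡ ∑ m f + ∑ n (λ i → f (m ℕ.+ i))
∑-split zero    n f = sym (ℤₚ.+-identityˡ _)
∑-split (suc m) n f = trans (cong (λ w → f 0 + w) (∑-split m n (f ∘ suc))) (sym (ℤₚ.+-assoc (f 0) _ _))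

∑-blocks : ∀ p L f → ∑ (L ℕ.* p) f ≡ ∑ L (λ j → ∑ p (λ i → f (j ℕ.* p ℕ.+ i)))
∑-blocks p zero    f = refl
∑-blocks p (suc L) f = begin
  ∑ (p ℕ.+ L ℕ.* p) f                                              ≡⟨ ∑-split p (L ℕ.* p) f ⟩
  ∑ p f + ∑ (L ℕ.* p) (λ i → f (p ℕ.+ i))                          ≡⟨ cong (λ w → ∑ p f + w) (∑-blocks p L _) ⟩
  ∑ p f + ∑ L (λ j → ∑ p (λ i → f (p ℕ.+ (j ℕ.* p ℕ.+ i))))        ≡⟨ cong (λ w → ∑ p f + w) (∑-cong L λ j → ∑-cong p λ i → cong f (ℕₚ.+-assoc p (j ℕ.* p) i)) ⟨
  ∑ p f + ∑ L (λ j → ∑ p (λ i → f (suc j ℕ.* p ℕ.+ i)))            ∎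
  where open ≡-Reasoning

∏-Unit : ∀ {m} n {f} → (∀ i → i ℕ.< n → Unit m (f i)) → Unit m (∏ n f)
∏-Unit zero    u = Unit-1
∏-Unit (suc n) u = Unit-* (u 0 (s≤s z≤n)) (∏-Unit n λ i i<n → u (suc i) (s≤s i<n))

-- Taking `f` on ℤ avoids truncated subtraction in the reversed index.
∏-reverse : ∀ n (f : ℤ → ℤ) → ∏ n (λ i → f (+ n - + suc i)) ≡ ∏ n (λ i → f (+ i))
∏-reverse zero    f = refl
∏-reverse (suc n) f = begin
  f (+ suc n - 1ℤ) * ∏ n (λ i → f (+ suc n - + suc (suc i)))  ≡⟨ cong₂ _*_ (cong f (lemma₁ (+ n))) (∏-cong n λ i → cong f (lemma₂ (+ n) (+ i))) ⟩
  f (+ n) * ∏ n (λ i → f (+ n - + suc i))                      ≡⟨ cong (f (+ n) *_) (∏-reverse n f) ⟩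
  f (+ n) * ∏ n (λ i → f (+ i))                                ≡⟨ ℤₚ.*-comm (f (+ n)) _ ⟩
  ∏ n (λ i → f (+ i)) * f (+ n)                                ≡⟨ ∏-snoc n (λ i → f (+ i)) ⟨
  ∏ (suc n) (λ i → f (+ i))                                    ∎
  where
  open ≡-Reasoning
  lemma₁ : ∀ n → 1ℤ + n - 1ℤ ≡ n
  lemma₁ = solve-∀
  lemma₂ : ∀ n i → 1ℤ + n - (1ℤ + (1ℤ + i)) ≡ n - (1ℤ + i)
  lemma₂ = solve-∀


-- Binomial coefficients and the terms of the Apéry sum

-- Induction on `n` through Pascal's rule. This identity drives both factors of the recurrence for
-- `t`.
absorption : ∀ n k → suc k ℕ.* (suc n C suc k) ≡ suc n ℕ.* (n C k)
absorption zero    zero    = refl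
absorption zero    (suc k) = ℕₚ.*-zeroʳ (suc (suc k))
absorption (suc n) zero    = begin
  1 ℕ.* (suc (suc n) C 1)                  ≡⟨ cong (1 ℕ.*_) (nCk+nC[k+1]≡[n+1]C[k+1] (suc n) 0) ⟨
  1 ℕ.* (1 ℕ.+ (suc n C 1))                ≡⟨ cong (λ w → 1 ℕ.* (1 ℕ.+ w)) (trans (sym (ℕₚ.*-identityˡ _)) (absorption n 0)) ⟩
  1 ℕ.* (1 ℕ.+ suc n ℕ.* 1)                ≡⟨ lemma n ⟩
  suc (suc n) ℕ.* 1                        ∎
  where
  open ≡-Reasoning
  lemma : ∀ n → 1 ℕ.* (1 ℕ.+ suc n ℕ.* 1) ≡ suc (suc n) ℕ.* 1
  lemma = ℕ-Solver.solve-∀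
absorption (suc n) (suc k) = begin
  suc (suc k) ℕ.* (suc (suc n) C suc (suc k))                          ≡⟨ cong (suc (suc k) ℕ.*_) (nCk+nC[k+1]≡[n+1]C[k+1] (suc n) (suc k)) ⟨
  suc (suc k) ℕ.* (x ℕ.+ (suc n C suc (suc k)))                        ≡⟨ lemma₁ k x (suc n C suc (suc k)) ⟩
  x ℕ.+ suc k ℕ.* x ℕ.+ suc (suc k) ℕ.* (suc n C suc (suc k))          ≡⟨ cong₂ (λ u v → x ℕ.+ u ℕ.+ v) (absorption n k) (absorption n (suc k)) ⟩
  x ℕ.+ suc n ℕ.* (n C k) ℕ.+ suc n ℕ.* (n C suc k)                    ≡⟨ lemma₂ n x (n C k) (n C suc k) ⟩
  x ℕ.+ suc n ℕ.* ((n C k) ℕ.+ (n C suc k))                            ≡⟨ cong (λ w → x ℕ.+ suc n ℕ.* w) (nCk+nC[k+1]≡[n+1]C[k+1] n k) ⟩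
  x ℕ.+ suc n ℕ.* x                                                    ∎
  where
  open ≡-Reasoning
  x = suc n C suc k
  lemma₁ : ∀ k x y → suc (suc k) ℕ.* (x ℕ.+ y) ≡ x ℕ.+ suc k ℕ.* x ℕ.+ suc (suc k) ℕ.* y
  lemma₁ = ℕ-Solver.solve-∀
  lemma₂ : ∀ n x a b → x ℕ.+ suc n ℕ.* a ℕ.+ suc n ℕ.* b ≡ x ℕ.+ suc n ℕ.* (a ℕ.+ b)
  lemma₂ = ℕ-Solver.solve-∀

-- This is (k+1) C(n,k+1) = (n-k) C(n,k) with the subtraction moved across, so that it makes sense
-- in ℕ.
C-sucʳ : ∀ n k → suc k ℕ.* (n C suc k) ℕ.+ k ℕ.* (n C k) ≡ n ℕ.* (n C k)
C-sucʳ n k = ℕₚ.+-cancelˡ-≡ (n C k) _ _ (begin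
  n C k ℕ.+ (suc k ℕ.* (n C suc k) ℕ.+ k ℕ.* (n C k))  ≡⟨ lemma k (n C k) (n C suc k) ⟩
  suc k ℕ.* (n C k ℕ.+ (n C suc k))                    ≡⟨ cong (suc k ℕ.*_) (nCk+nC[k+1]≡[n+1]C[k+1] n k) ⟩
  suc k ℕ.* (suc n C suc k)                            ≡⟨ absorption n k ⟩
  suc n ℕ.* (n C k)                                    ∎)
  where
  open ≡-Reasoning
  lemma : ∀ k a b → a ℕ.+ (suc k ℕ.* b ℕ.+ k ℕ.* a) ≡ suc k ℕ.* (a ℕ.+ b)
  lemma = ℕ-Solver.solve-∀

t : ℕ → ℕ → ℤ
t n k = + (n C k) * + ((n ℕ.+ k) C k)

t-vanishes : ∀ {n k} → n ℕ.< k → t n k ≡ 0ℤ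
t-vanishes {n} {k} n<k =
  trans (cong (λ w → + w * + ((n ℕ.+ k) C k)) (k>n⇒nCk≡0 n<k)) (ℤₚ.*-zeroˡ (+ ((n ℕ.+ k) C k)))

pos-identity : ∀ a b c d → a ℕ.* b ≡ c ℕ.* d → + a * + b ≡ + c * + d
pos-identity a b c d eq = trans (sym (ℤₚ.pos-* a b)) (trans (cong +_ eq) (ℤₚ.pos-* c d))

-- The first binomial contributes n - k and the second n + k + 1; their product is n(n+1) - k(k+1).
t-suc : ∀ n k → + suc k * + suc k * t n (suc k) ≡ (+ n * (+ n + 1ℤ) - + k * (+ k + 1ℤ)) * t n k
t-suc n k = begin
  K * K * (+ (n C suc k) * + ((n ℕ.+ suc k) C suc k))  ≡⟨ lemma₁ K (+ (n C suc k)) (+ ((n ℕ.+ suc k) C suc k)) ⟩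
  (K * + (n C suc k)) * (K * + ((n ℕ.+ suc k) C suc k)) ≡⟨ cong₂ _*_ first second ⟩
  ((N - + k) * a) * ((N + K) * b)                       ≡⟨ lemma₂ N (+ k) a b ⟩
  (N * (N + 1ℤ) - + k * (+ k + 1ℤ)) * (a * b)           ∎
  where
  open ≡-Reasoning
  K = + suc k
  N = + n
  a = + (n C k)
  b = + ((n ℕ.+ k) C k)
  first : K * + (n C suc k) ≡ (N - + k) * a
  first = begin
    K * + (n C suc k)                        ≡⟨ lemma (K * + (n C suc k)) (+ k * a) ⟩
    K * + (n C suc k) + + k * a - + k * a    ≡⟨ cong (λ w → w - + k * a) (cong₂ _+_ (ℤₚ.pos-* (suc k) _) (ℤₚ.pos-* k _)) ⟨
    + (suc k ℕ.* (n C suc k) ℕ.+ k ℕ.* (n C k)) - + k * a ≡⟨ cong (λ w → + w - + k * a) (C-sucʳ n k) ⟩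
    + (n ℕ.* (n C k)) - + k * a              ≡⟨ cong (λ w → w - + k * a) (ℤₚ.pos-* n _) ⟩
    N * a - + k * a                          ≡⟨ lemma′ N (+ k) a ⟩
    (N - + k) * a                            ∎
    where
    lemma : ∀ x y → x ≡ x + y - y
    lemma = solve-∀
    lemma′ : ∀ n k a → n * a - k * a ≡ (n - k) * a
    lemma′ = solve-∀
  second : K * + ((n ℕ.+ suc k) C suc k) ≡ (N + K) * b
  second = begin
    K * + ((n ℕ.+ suc k) C suc k)   ≡⟨ cong (λ w → K * + (w C suc k)) (ℕₚ.+-suc n k) ⟩
    K * + (suc (n ℕ.+ k) C suc k)   ≡⟨ pos-identity (suc k) (suc (n ℕ.+ k) C suc k) (suc (n ℕ.+ k)) ((n ℕ.+ k) C k) (absorption (n ℕ.+ k) k) ⟩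
    + suc (n ℕ.+ k) * b             ≡⟨ cong (λ w → + w * b) (ℕₚ.+-suc n k) ⟨
    (N + K) * b                     ∎
  lemma₁ : ∀ k x y → k * k * (x * y) ≡ (k * x) * (k * y)
  lemma₁ = solve-∀
  lemma₂ : ∀ n k a b → ((n - k) * a) * ((n + (1ℤ + k)) * b) ≡ (n * (n + 1ℤ) - k * (k + 1ℤ)) * (a * b)
  lemma₂ = solve-∀

t² : ℕ → ℕ → ℤ
t² n k = t n k * t n k

pos-sum-applyUpTo : ∀ f n → + sum (applyUpTo f n) ≡ ∑ n (λ i → + f i)
pos-sum-applyUpTo f zero    = refl
pos-sum-applyUpTo f (suc n) = cong (λ w → + f 0 + w) (pos-sum-applyUpTo (f ∘ suc) n)

-- Terms with k > n vanish, so the range can be lengthened at will and sums for different `n` can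
-- share one range.
apéryℕ-∑ : ∀ n m → + apéryℕ n ≡ ∑ (suc n ℕ.+ m) (t² n)
apéryℕ-∑ n m = begin
  + apéryℕ n                                         ≡⟨ cong (λ w → + sum w) (map-upTo f (suc n)) ⟩
  + sum (applyUpTo f (suc n))                        ≡⟨ pos-sum-applyUpTo f (suc n) ⟩
  ∑ (suc n) (λ k → + f k)                            ≡⟨ ∑-cong (suc n) pos-f ⟩
  ∑ (suc n) (t² n)                                   ≡⟨ ℤₚ.+-identityʳ _ ⟨
  ∑ (suc n) (t² n) + 0ℤ                              ≡⟨ cong (λ w → ∑ (suc n) (t² n) + w) tail ⟨
  ∑ (suc n) (t² n) + ∑ m (λ i → t² n (suc n ℕ.+ i))  ≡⟨ ∑-split (suc n) m (t² n) ⟨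
  ∑ (suc n ℕ.+ m) (t² n)                             ∎
  where
  open ≡-Reasoning
  f : ℕ → ℕ
  f k = (n C k) ℕ.^ 2 ℕ.* ((n ℕ.+ k) C k) ℕ.^ 2
  pos-f : ∀ k → + f k ≡ t² n k
  pos-f k = trans (cong +_ (lemma a b))
                  (trans (ℤₚ.pos-* (a ℕ.* b) (a ℕ.* b)) (cong (λ w → w * w) (ℤₚ.pos-* a b)))
    where
    a = n C k
    b = (n ℕ.+ k) C k
    lemma : ∀ a b → (a ℕ.* (a ℕ.* 1)) ℕ.* (b ℕ.* (b ℕ.* 1)) ≡ (a ℕ.* b) ℕ.* (a ℕ.* b)
    lemma = ℕ-Solver.solve-∀
  tail : ∑ m (λ i → t² n (suc n ℕ.+ i)) ≡ 0ℤ
  tail = trans (∑-cong m λ i → cong (λ w → w * w) (t-vanishes (ℕₚ.m≤m+n (suc n) i))) (∑-zero m)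

apéryℕ-∑-≥ : ∀ {n K} → n ℕ.< K → + apéryℕ n ≡ ∑ K (t² n)
apéryℕ-∑-≥ {n} n<K with ℕₚ.m≤n⇒∃[o]m+o≡n n<K
... | m , refl = apéryℕ-∑ n m

-- Integer arguments and the reflection of z to -1-z

rep : ℤ → ℕ
rep (+ n)    = n
rep -[1+ m ] = m

A-rep : ∀ z → A z ≡ + apéryℕ (rep z)
A-rep (+ n)    = refl
A-rep -[1+ m ] = refl

rep-* : ∀ z → + rep z * (+ rep z + 1ℤ) ≡ z * (z + 1ℤ)
rep-* (+ n)    = refl
rep-* -[1+ m ] = lemma (+ m)
  where
  lemma : ∀ m → m * (m + 1ℤ) ≡ - (1ℤ + m) * (- (1ℤ + m) + 1ℤ)
  lemma = solve-∀

A-reflect : ∀ z → A (- 1ℤ - z) ≡ A z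
A-reflect (+ n)    = cong A (lemma n)
  where
  lemma : ∀ n → - 1ℤ - + n ≡ -[1+ n ]
  lemma zero    = refl
  lemma (suc n) = refl
A-reflect -[1+ m ] = refl

t-suc-ℤ : ∀ z k → + suc k * + suc k * t (rep z) (suc k) ≡ (z * (z + 1ℤ) - + k * (+ k + 1ℤ)) * t (rep z) k
t-suc-ℤ z k = trans (t-suc (rep z) k) (cong (λ w → (w - + k * (+ k + 1ℤ)) * t (rep z) k) (rep-* z))

-- The congruence modulo 8

-- Serves twice: the factor 2 gives the parity of `t`, and the two summands on the right make the
-- alternating sum telescope.
t-suc-sum : ∀ n k → t n (suc k) + t (suc n) (suc k) ≡
  + 2 * (+ (n C k) * + ((n ℕ.+ suc k) C k) + + (n C suc k) * + (suc (n ℕ.+ suc k) C suc k))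
t-suc-sum n k = begin
  b * e + + (suc n C suc k) * + (suc M C suc k)              ≡⟨ cong₂ (λ x y → b * e + x * y) (pascal n k) (pascal M k) ⟩
  b * e + (a + b) * (c + e)                                  ≡⟨ lemma₁ a b c e ⟩
  + 2 * (b * e) + b * c + a * c + a * e                      ≡⟨ cong (λ w → + 2 * (b * e) + b * c + a * c + w) swap ⟩
  + 2 * (b * e) + b * c + a * c + (a + b) * c                ≡⟨ lemma₂ a b c e ⟩
  + 2 * (a * c + b * (c + e))                                ≡⟨ cong (λ w → + 2 * (a * c + b * w)) (pascal M k) ⟨
  + 2 * (a * c + b * + (suc M C suc k))                      ∎
  where
  open ≡-Reasoning
  M = n ℕ.+ suc k
  a = + (n C k)
  b = + (n C suc k)
  c = + (M C k)
  e = + (M C suc k)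
  pascal : ∀ n k → + (suc n C suc k) ≡ + (n C k) + + (n C suc k)
  pascal n k = cong +_ (sym (nCk+nC[k+1]≡[n+1]C[k+1] n k))
  -- After multiplication by k + 1 both sides equal (n+1) a c: absorption treats a + b = C(n+1,k+1),
  -- and M - k = n + 1 treats e.
  swap : a * e ≡ (a + b) * c
  swap = ℤₚ.*-cancelˡ-≡ (+ suc k) _ _ (begin
    + suc k * (a * e)                ≡⟨ lemma (+ suc k) a e ⟩
    a * (+ suc k * e)                ≡⟨ cong (a *_) step ⟩
    a * (+ suc n * c)                ≡⟨ lemma′ a (+ suc n) c ⟩
    (+ suc n * a) * c                ≡⟨ cong (_* c) (pos-identity (suc k) (suc n C suc k) (suc n) (n C k) (absorption n k)) ⟨
    (+ suc k * + (suc n C suc k)) * c ≡⟨ cong (λ w → (+ suc k * w) * c) (pascal n k) ⟩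
    (+ suc k * (a + b)) * c          ≡⟨ ℤₚ.*-assoc (+ suc k) (a + b) c ⟩
    + suc k * ((a + b) * c)          ∎)
    where
    lemma : ∀ k a e → k * (a * e) ≡ a * (k * e)
    lemma = solve-∀
    lemma′ : ∀ a n c → a * (n * c) ≡ (n * a) * c
    lemma′ = solve-∀
    step : + suc k * e ≡ + suc n * c
    step = pos-identity (suc k) (M C suc k) (suc n) (M C k) (ℕₚ.+-cancelʳ-≡ (k ℕ.* (M C k)) _ _ (trans (C-sucʳ M k) (lemma″ n k (M C k))))
      where
      lemma″ : ∀ n k c → (n ℕ.+ suc k) ℕ.* c ≡ suc n ℕ.* c ℕ.+ k ℕ.* c
      lemma″ = ℕ-Solver.solve-∀
  lemma₁ : ∀ a b c e → b * e + (a + b) * (c + e) ≡ + 2 * (b * e) + b * c + a * c + a * e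
  lemma₁ = solve-∀
  lemma₂ : ∀ a b c e → + 2 * (b * e) + b * c + a * c + (a + b) * c ≡ + 2 * (a * c + b * (c + e))
  lemma₂ = solve-∀

-- Induction on `n`: the sum of the terms for n and n + 1 is even by `t-suc-sum`, and the terms for
-- n = 0 vanish.
t-even : ∀ n k → t n (suc k) ≈ 0ℤ [ + 2 ]
t-even zero    k = ≈-reflexive (t-vanishes {0} {suc k} (s≤s z≤n))
t-even (suc n) k = begin
  t (suc n) (suc k)                                        ≡⟨ lemma (t n (suc k)) (t (suc n) (suc k)) ⟩
  (t n (suc k) + t (suc n) (suc k)) + - 1ℤ * t n (suc k)   ≈⟨ +-cong (≈-trans (≈-reflexive (t-suc-sum n k)) (multiple _)) (*-zeroʳ-≈ (- 1ℤ) (t-even n k)) ⟩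
  0ℤ                                                       ∎
  where
  open ≈-Reasoning (+ 2)
  lemma : ∀ x y → y ≡ (x + y) + - 1ℤ * x
  lemma = solve-∀

sign : ℕ → ℤ
sign zero    = 1ℤ
sign (suc n) = - sign n

-- Found by Zeilberger's method; the right-hand side vanishes for K > n.
alternating-step : ∀ n K → ∑ (suc K) (λ k → sign k * (t n k + t (suc n) k)) ≡
  + 2 * (sign K * (+ (n C K) * + ((n ℕ.+ suc K) C K)))
alternating-step n zero    = refl
alternating-step n (suc K) = begin
  ∑ (suc (suc K)) f                              ≡⟨ ∑-snoc (suc K) f ⟩
  ∑ (suc K) f + f (suc K)                        ≡⟨ cong₂ _+_ (alternating-step n K) (cong (sign (suc K) *_) (t-suc-sum n K)) ⟩
  + 2 * (sign K * x) + - sign K * (+ 2 * (x + y)) ≡⟨ lemma (sign K) x y ⟩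
  + 2 * (- sign K * y)                           ≡⟨ cong (λ w → + 2 * (- sign K * (+ (n C suc K) * + (w C suc K)))) (ℕₚ.+-suc n (suc K)) ⟨
  + 2 * (- sign K * (+ (n C suc K) * + ((n ℕ.+ suc (suc K)) C suc K))) ∎
  where
  open ≡-Reasoning
  f : ℕ → ℤ
  f k = sign k * (t n k + t (suc n) k)
  x = + (n C K) * + ((n ℕ.+ suc K) C K)
  y = + (n C suc K) * + (suc (n ℕ.+ suc K) C suc K)
  lemma : ∀ s x y → + 2 * (s * x) + - s * (+ 2 * (x + y)) ≡ + 2 * (- s * y)
  lemma = solve-∀

-- For n < K + 1 fixed, the closed form in `alternating-step` contains C(n,K), which vanishes once n
-- < K; consecutive sums over the common range are therefore opposite.
alternating-∑ : ∀ n K → n ℕ.≤ K → ∑ (suc K) (λ k → sign k * t n k) ≡ sign n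
alternating-∑ zero    K _   = trans (cong (λ w → 1ℤ + w) (trans (∑-cong K λ k → trans (cong (sign (suc k) *_) (t-vanishes {0} {suc k} (s≤s z≤n))) (ℤₚ.*-zeroʳ (sign (suc k)))) (∑-zero K))) refl
alternating-∑ (suc n) K n<K = begin
  S (suc n)                                   ≡⟨ lemma (S n) (S (suc n)) ⟩
  (S n + S (suc n)) - S n                     ≡⟨ cong₂ _-_ total (alternating-∑ n K (ℕₚ.<⇒≤ n<K)) ⟩
  0ℤ - sign n                                 ≡⟨ ℤₚ.+-identityˡ _ ⟩
  - sign n                                    ∎
  where
  open ≡-Reasoning
  S : ℕ → ℤ
  S n = ∑ (suc K) (λ k → sign k * t n k)
  lemma : ∀ x y → y ≡ (x + y) - x
  lemma = solve-∀
  total : S n + S (suc n) ≡ 0ℤ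
  total = begin
    S n + S (suc n)                                       ≡⟨ ∑-+ (suc K) (λ k → sign k * t n k) (λ k → sign k * t (suc n) k) ⟨
    ∑ (suc K) (λ k → sign k * t n k + sign k * t (suc n) k) ≡⟨ ∑-cong (suc K) (λ k → ℤₚ.*-distribˡ-+ (sign k) (t n k) (t (suc n) k)) ⟨
    ∑ (suc K) (λ k → sign k * (t n k + t (suc n) k))      ≡⟨ alternating-step n K ⟩
    + 2 * (sign K * (+ (n C K) * c))                      ≡⟨ cong (λ w → + 2 * (sign K * (+ w * c))) (k>n⇒nCk≡0 n<K) ⟩
    + 2 * (sign K * (0ℤ * c))                             ≡⟨ zero-lemma (sign K) c ⟩
    0ℤ                                                    ∎
    where
    c = + ((n ℕ.+ suc K) C K)
    zero-lemma : ∀ s c → + 2 * (s * (0ℤ * c)) ≡ 0ℤ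
    zero-lemma = solve-∀

sign-odd : ∀ n → sign n ≈ 1ℤ [ + 2 ]
sign-odd zero    = ≈-refl
sign-odd (suc n) = ≈-trans (≈-reflexive (lemma (sign n))) (≈-trans (*-congˡ (- 1ℤ) (sign-odd n)) (- 1ℤ by refl))
  where
  lemma : ∀ s → - s ≡ - 1ℤ * s
  lemma = solve-∀

sq≈id-pos : ∀ n → + n * + n ≈ + n [ + 2 ]
sq≈id-pos zero    = ≈-refl
sq≈id-pos (suc n) = begin
  (1ℤ + + n) * (1ℤ + + n)          ≡⟨ lemma (+ n) ⟩
  1ℤ + + n * + n + + 2 * + n       ≈⟨ +-cong (+-cong (≈-refl {a = 1ℤ}) (sq≈id-pos n)) (multiple (+ n)) ⟩
  1ℤ + + n + 0ℤ                    ≡⟨ ℤₚ.+-identityʳ _ ⟩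
  + suc n                          ∎
  where
  open ≈-Reasoning (+ 2)
  lemma : ∀ n → (1ℤ + n) * (1ℤ + n) ≡ 1ℤ + n * n + + 2 * n
  lemma = solve-∀

sq≈id : ∀ c → c * c ≈ c [ + 2 ]
sq≈id (+ n)    = sq≈id-pos n
sq≈id -[1+ n ] = ≈-trans (sq≈id-pos (suc n)) (+ suc n by lemma (+ suc n))
  where
  lemma : ∀ c → c ≡ - c + c * + 2
  lemma = solve-∀

-- For x = 2c both sides are 4c modulo 8: on the left because c² and c have the same parity, on the
-- right because s is odd.
even-square : ∀ {s x} → s ≈ 1ℤ [ + 2 ] → x ≈ 0ℤ [ + 2 ] → x * x ≈ + 2 * (s * x) [ + 8 ]
even-square (d by refl) (c by refl) with sq≈id c
... | e by c²≡c+2e = (e - c * d) by (begin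
  (0ℤ + c * + 2) * (0ℤ + c * + 2)                                       ≡⟨ lemma₁ c ⟩
  + 4 * (c * c)                                                         ≡⟨ cong (+ 4 *_) c²≡c+2e ⟩
  + 4 * (c + e * + 2)                                                   ≡⟨ lemma₂ c d e ⟩
  + 2 * ((1ℤ + d * + 2) * (0ℤ + c * + 2)) + (e - c * d) * + 8           ∎)
  where
  open ≡-Reasoning
  lemma₁ : ∀ c → (0ℤ + c * + 2) * (0ℤ + c * + 2) ≡ + 4 * (c * c)
  lemma₁ = solve-∀
  lemma₂ : ∀ c d e → + 4 * (c + e * + 2) ≡ + 2 * ((1ℤ + d * + 2) * (0ℤ + c * + 2)) + (e - c * d) * + 8
  lemma₂ = solve-∀

-- The term at k = 0 is 1, whereas the rule 2 (-1)^k t would give 2 there; hence the summand -1.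
apéryℕ-mod-8 : ∀ n → + apéryℕ n ≈ + 2 * sign n - 1ℤ [ + 8 ]
apéryℕ-mod-8 n = begin
  + apéryℕ n                                            ≡⟨ apéryℕ-∑-≥ (ℕₚ.n<1+n n) ⟩
  1ℤ + ∑ n (λ k → t² n (suc k))                         ≈⟨ +-cong (≈-refl {a = 1ℤ}) (∑-≈ n λ k _ → even-square (sign-odd (suc k)) (t-even n k)) ⟩
  1ℤ + ∑ n (λ k → + 2 * (sign (suc k) * t n (suc k)))   ≡⟨ cong (λ w → 1ℤ + w) (∑-*ˡ (+ 2) n (λ k → sign (suc k) * t n (suc k))) ⟩
  1ℤ + + 2 * ∑ n (λ k → sign (suc k) * t n (suc k))     ≡⟨ lemma (∑ n (λ k → sign (suc k) * t n (suc k))) ⟩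
  + 2 * ∑ (suc n) (λ k → sign k * t n k) - 1ℤ           ≡⟨ cong (λ w → + 2 * w - 1ℤ) (alternating-∑ n n ℕₚ.≤-refl) ⟩
  + 2 * sign n - 1ℤ                                     ∎
  where
  open ≈-Reasoning (+ 8)
  lemma : ∀ x → 1ℤ + + 2 * x ≡ + 2 * (1ℤ + x) - 1ℤ
  lemma = solve-∀

-- The closed form alternates between 1 and -3, which are the powers of 5 modulo 8.
5^n-mod-8 : ∀ n → (+ 5) ^ n ≈ + 2 * sign n - 1ℤ [ + 8 ]
5^n-mod-8 zero    = ≈-refl
5^n-mod-8 (suc n) = ≈-trans (*-congˡ (+ 5) (5^n-mod-8 n)) (step (sign-odd n))
  where
  step : ∀ {s} → s ≈ 1ℤ [ + 2 ] → + 5 * (+ 2 * s - 1ℤ) ≈ + 2 * - s - 1ℤ [ + 8 ]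
  step (d by refl) = (1ℤ + + 3 * d) by lemma d
    where
    lemma : ∀ d → + 5 * (+ 2 * (1ℤ + d * + 2) - 1ℤ) ≡ + 2 * - (1ℤ + d * + 2) - 1ℤ + (1ℤ + + 3 * d) * + 8
    lemma = solve-∀

apéryℕ≈5^n : ∀ n → + apéryℕ n ≈ (+ 5) ^ n [ + 8 ]
apéryℕ≈5^n n = ≈-trans (apéryℕ-mod-8 n) (≈-sym (5^n-mod-8 n))

-- At the negative integer -1-n the claimed residue is the inverse of 5^n, so the congruence is
-- multiplied out. It holds because the closed form common to both factors is odd and odd squares
-- are 1 modulo 8.
5^n*apéryℕ≈1 : ∀ n → (+ 5) ^ n * + apéryℕ n ≈ 1ℤ [ + 8 ]
5^n*apéryℕ≈1 n = ≈-trans (*-cong (5^n-mod-8 n) (apéryℕ-mod-8 n)) (square (sign-odd n))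
  where
  square : ∀ {s} → s ≈ 1ℤ [ + 2 ] → (+ 2 * s - 1ℤ) * (+ 2 * s - 1ℤ) ≈ 1ℤ [ + 8 ]
  square (d by refl) = (d * (1ℤ + + 2 * d)) by lemma d
    where
    lemma : ∀ d → (+ 2 * (1ℤ + d * + 2) - 1ℤ) * (+ 2 * (1ℤ + d * + 2) - 1ℤ) ≡ 1ℤ + d * (1ℤ + + 2 * d) * + 8
    lemma = solve-∀

-- Sums over blocks of consecutive indices

apéryℕ-blocks : ∀ {m} q N n c → (∀ j → ∑ (suc q) (λ i → t² N (j ℕ.* suc q ℕ.+ i)) ≈ c * t² n j [ m ]) →
  + apéryℕ N ≈ c * + apéryℕ n [ m ]
apéryℕ-blocks {m} q N n c block = begin
  + apéryℕ N                                                  ≡⟨ apéryℕ-∑-≥ N<L*p ⟩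
  ∑ (L ℕ.* suc q) (t² N)                                      ≡⟨ ∑-blocks (suc q) L (t² N) ⟩
  ∑ L (λ j → ∑ (suc q) (λ i → t² N (j ℕ.* suc q ℕ.+ i)))      ≈⟨ ∑-≈ L (λ j _ → block j) ⟩
  ∑ L (λ j → c * t² n j)                                      ≡⟨ ∑-*ˡ c L (t² n) ⟩
  c * ∑ L (t² n)                                              ≡⟨ cong (c *_) (apéryℕ-∑-≥ (s≤s (ℕₚ.m≤n+m n N))) ⟨
  c * + apéryℕ n                                              ∎
  where
  open ≈-Reasoning m
  -- Large enough for both sums: `N` lies below L (q + 1) and `n` below L.
  L = suc (N ℕ.+ n)
  N<L*p : N ℕ.< L ℕ.* suc q
  N<L*p = ℕₚ.≤-trans (s≤s (ℕₚ.m≤m+n N n)) (ℕₚ.m≤m*n L (suc q))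

iterate-∏ : ∀ (a b x : ℕ → ℤ) → (∀ i → a i * x (suc i) ≡ b i * x i) → ∀ n → ∏ n a * x n ≡ ∏ n b * x 0
iterate-∏ a b x step zero    = refl
iterate-∏ a b x step (suc n) = begin
  ∏ (suc n) a * x (suc n)        ≡⟨ cong (_* x (suc n)) (∏-snoc n a) ⟩
  ∏ n a * a n * x (suc n)        ≡⟨ ℤₚ.*-assoc (∏ n a) (a n) (x (suc n)) ⟩
  ∏ n a * (a n * x (suc n))      ≡⟨ cong (∏ n a *_) (step n) ⟩
  ∏ n a * (b n * x n)            ≡⟨ lemma (∏ n a) (b n) (x n) ⟩
  b n * (∏ n a * x n)            ≡⟨ cong (b n *_) (iterate-∏ a b x step n) ⟩
  b n * (∏ n b * x 0)            ≡⟨ lemma′ (∏ n b) (b n) (x 0) ⟨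
  ∏ n b * b n * x 0              ≡⟨ cong (_* x 0) (∏-snoc n b) ⟨
  ∏ (suc n) b * x 0              ∎
  where
  open ≡-Reasoning
  lemma : ∀ a b x → a * (b * x) ≡ b * (a * x)
  lemma = solve-∀
  lemma′ : ∀ a b x → a * b * x ≡ b * (a * x)
  lemma′ = solve-∀

-- In the applications the common factors `c` and `d` are multiples of p², hence not invertible
-- modulo the target. So `c` is cancelled here, exactly in ℤ, before any reduction; `d` may be zero
-- and is only carried along.
compare-∏ : ∀ (c d u v x y : ℕ → ℤ) → (∀ j → ℤ.NonZero (c j)) →
  (∀ j → c j * u j * x (suc j) ≡ d j * v j * x j) → (∀ j → c j * y (suc j) ≡ d j * y j) →
  x 0 ≡ y 0 → ∀ n → ∏ n u * x n ≡ ∏ n v * y n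
compare-∏ c d u v x y c≢0 x-step y-step x₀≡y₀ zero    = cong (1ℤ *_) x₀≡y₀
compare-∏ c d u v x y c≢0 x-step y-step x₀≡y₀ (suc n) = ℤₚ.*-cancelˡ-≡ (c n) _ _ {{c≢0 n}} (begin
  c n * (∏ (suc n) u * x (suc n))     ≡⟨ cong (λ w → c n * (w * x (suc n))) (∏-snoc n u) ⟩
  c n * (∏ n u * u n * x (suc n))     ≡⟨ lemma₁ (c n) (∏ n u) (u n) (x (suc n)) ⟩
  ∏ n u * (c n * u n * x (suc n))     ≡⟨ cong (∏ n u *_) (x-step n) ⟩
  ∏ n u * (d n * v n * x n)           ≡⟨ lemma₂ (∏ n u) (d n) (v n) (x n) ⟩
  d n * v n * (∏ n u * x n)           ≡⟨ cong (d n * v n *_) (compare-∏ c d u v x y c≢0 x-step y-step x₀≡y₀ n) ⟩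
  d n * v n * (∏ n v * y n)           ≡⟨ lemma₃ (d n) (v n) (∏ n v) (y n) ⟩
  ∏ n v * v n * (d n * y n)           ≡⟨ cong₂ _*_ (∏-snoc n v) (y-step n) ⟨
  ∏ (suc n) v * (c n * y (suc n))     ≡⟨ lemma₄ (∏ (suc n) v) (c n) (y (suc n)) ⟩
  c n * (∏ (suc n) v * y (suc n))     ∎)
  where
  open ≡-Reasoning
  lemma₁ : ∀ c u u′ x → c * (u * u′ * x) ≡ u * (c * u′ * x)
  lemma₁ = solve-∀
  lemma₂ : ∀ u d v x → u * (d * v * x) ≡ d * v * (u * x)
  lemma₂ = solve-∀
  lemma₃ : ∀ d v v′ y → d * v * (v′ * y) ≡ v′ * v * (d * y)
  lemma₃ = solve-∀
  lemma₄ : ∀ v c y → v * (c * y) ≡ c * (v * y)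
  lemma₄ = solve-∀

-- The prime is p = q + 1, and i stands for the residue i + 1.
F : ℕ → ℤ → ℤ
F q x = ∏ q (λ i → + suc q * x + + suc i)

-- With r replaced by p - r, the factor p x - r becomes p (x-1) + r.
F-reverse : ∀ q x → ∏ q (λ i → + suc q * x - + suc i) ≡ F q (x - 1ℤ)
F-reverse q x = trans (∏-cong q λ i → lemma (+ q) x (+ i))
                      (∏-reverse q (λ y → + suc q * (x - 1ℤ) + (1ℤ + y)))
  where
  lemma : ∀ q x i → (1ℤ + q) * x - (1ℤ + i) ≡ (1ℤ + q) * (x - 1ℤ) + (1ℤ + (q - (1ℤ + i)))
  lemma = solve-∀

-- The terms at multiples of p

module _ (q : ℕ) where

  private
    p = suc q
    P = + p

  pos-index : ∀ j i → + (j ℕ.* p ℕ.+ i) ≡ P * + j + + i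
  pos-index j i = cong (λ w → w + + i) (trans (ℤₚ.pos-* j p) (ℤₚ.*-comm (+ j) P))

  -- For k = p j + i each factor splits as (p z - k)(p z + k + 1). The multiples of p among these
  -- are p(z-j), at i = 0, and p(z+j+1), at i = q; they form p² times the step factor for z, and the
  -- rest are values of `F`.
  block-numerator : ∀ z j →
    ∏ p (λ i → (P * z) * (P * z + 1ℤ) - + (j ℕ.* p ℕ.+ i) * (+ (j ℕ.* p ℕ.+ i) + 1ℤ)) ≡
    P * P * (z * (z + 1ℤ) - + j * (+ j + 1ℤ)) * (F q (z - + j - 1ℤ) * F q (z + + j))
  block-numerator z j = begin
    ∏ p (λ i → (P * z) * (P * z + 1ℤ) - + (j ℕ.* p ℕ.+ i) * (+ (j ℕ.* p ℕ.+ i) + 1ℤ))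
      ≡⟨ ∏-cong p (λ i → trans (cong (λ w → (P * z) * (P * z + 1ℤ) - w * (w + 1ℤ)) (pos-index j i))
                               (lemma₁ P z (+ j) (+ i))) ⟩
    ∏ p (λ i → (P * (z - + j) - + i) * (P * (z + + j) + + suc i))
      ≡⟨ ∏-* p (λ i → P * (z - + j) - + i) (λ i → P * (z + + j) + + suc i) ⟩
    (P * (z - + j) - 0ℤ) * ∏ q (λ i → P * (z - + j) - + suc i) * ∏ p (λ i → P * (z + + j) + + suc i)
      ≡⟨ cong₂ (λ x y → (P * (z - + j) - 0ℤ) * x * y) (F-reverse q (z - + j))
               (∏-snoc q (λ i → P * (z + + j) + + suc i)) ⟩
    (P * (z - + j) - 0ℤ) * F q (z - + j - 1ℤ) * (F q (z + + j) * (P * (z + + j) + P))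
      ≡⟨ lemma₂ P z (+ j) (F q (z - + j - 1ℤ)) (F q (z + + j)) ⟩
    P * P * (z * (z + 1ℤ) - + j * (+ j + 1ℤ)) * (F q (z - + j - 1ℤ) * F q (z + + j))  ∎
    where
    open ≡-Reasoning
    lemma₁ : ∀ P z j i → (P * z) * (P * z + 1ℤ) - (P * j + i) * ((P * j + i) + 1ℤ) ≡
      (P * (z - j) - i) * (P * (z + j) + (1ℤ + i))
    lemma₁ = solve-∀
    lemma₂ : ∀ P z j f g → (P * (z - j) - 0ℤ) * f * (g * (P * (z + j) + P)) ≡
      P * P * (z * (z + 1ℤ) - j * (j + 1ℤ)) * (f * g)
    lemma₂ = solve-∀

  block-denominator : ∀ j → ∏ p (λ i → + suc (j ℕ.* p ℕ.+ i) * + suc (j ℕ.* p ℕ.+ i)) ≡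
    P * P * (+ suc j * + suc j) * (F q (+ j) * F q (+ j))
  block-denominator j = begin
    ∏ p (λ i → + suc (j ℕ.* p ℕ.+ i) * + suc (j ℕ.* p ℕ.+ i))  ≡⟨ ∏-* p s s ⟩
    ∏ p s * ∏ p s                                              ≡⟨ cong (λ w → w * w) (trans (∏-cong p s≡) (∏-snoc q (λ i → P * + j + + suc i))) ⟩
    (F q (+ j) * (P * + j + P)) * (F q (+ j) * (P * + j + P))  ≡⟨ lemma P (+ j) (F q (+ j)) ⟩
    P * P * (+ suc j * + suc j) * (F q (+ j) * F q (+ j))      ∎
    where
    open ≡-Reasoning
    s : ℕ → ℤ
    s i = + suc (j ℕ.* p ℕ.+ i)
    s≡ : ∀ i → s i ≡ P * + j + + suc i
    s≡ i = trans (cong (λ w → 1ℤ + w) (pos-index j i)) (lemma′ (P * + j) (+ i))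
      where
      lemma′ : ∀ x i → 1ℤ + (x + i) ≡ x + (1ℤ + i)
      lemma′ = solve-∀
    lemma : ∀ P j f → (f * (P * j + P)) * (f * (P * j + P)) ≡ P * P * ((1ℤ + j) * (1ℤ + j)) * (f * f)
    lemma = solve-∀

  t-block : ∀ z j → let N = rep (P * z) in
    ∏ p (λ i → + suc (j ℕ.* p ℕ.+ i) * + suc (j ℕ.* p ℕ.+ i)) * t N (suc j ℕ.* p) ≡
    ∏ p (λ i → (P * z) * (P * z + 1ℤ) - + (j ℕ.* p ℕ.+ i) * (+ (j ℕ.* p ℕ.+ i) + 1ℤ)) * t N (j ℕ.* p)
  -- The p steps lead from index j p + 0 to j p + p; both indices are rewritten to the stated form.
  t-block z j = subst₂ (λ k l → ∏ p a * t N k ≡ ∏ p b * t N l) (ℕₚ.+-comm (j ℕ.* p) p) (ℕₚ.+-identityʳ (j ℕ.* p))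
    (iterate-∏ a b (λ i → t N (j ℕ.* p ℕ.+ i))
      (λ i → trans (cong (λ k → a i * t N k) (ℕₚ.+-suc (j ℕ.* p) i)) (t-suc-ℤ (P * z) (j ℕ.* p ℕ.+ i))) p)
    where
    N = rep (P * z)
    a b : ℕ → ℤ
    a i = + suc (j ℕ.* p ℕ.+ i) * + suc (j ℕ.* p ℕ.+ i)
    b i = (P * z) * (P * z + 1ℤ) - + (j ℕ.* p ℕ.+ i) * (+ (j ℕ.* p ℕ.+ i) + 1ℤ)

  t-multiples : ∀ z n → ∏ n (λ j → F q (+ j) * F q (+ j)) * t (rep (P * z)) (n ℕ.* p) ≡
    ∏ n (λ j → F q (z - + j - 1ℤ) * F q (z + + j)) * t (rep z) n
  t-multiples z = compare-∏ c d _ _ (λ j → t (rep (P * z)) (j ℕ.* p)) (t (rep z)) (λ _ → _)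
    (λ j → trans (cong (_* t (rep (P * z)) (suc j ℕ.* p)) (sym (block-denominator j)))
           (trans (t-block z j) (cong (_* t (rep (P * z)) (j ℕ.* p)) (block-numerator z j))))
    (λ j → trans (lemma P (+ suc j * + suc j) _) (trans (cong (P * P *_) (t-suc-ℤ z j)) (sym (ℤₚ.*-assoc (P * P) (z * (z + 1ℤ) - + j * (+ j + 1ℤ)) (t (rep z) j)))))
    refl
    where
    c d : ℕ → ℤ
    c j = P * P * (+ suc j * + suc j)
    d j = P * P * (z * (z + 1ℤ) - + j * (+ j + 1ℤ))
    lemma : ∀ P s x → P * P * s * x ≡ P * P * (s * x)
    lemma = solve-∀

  -- What the comparison of terms requires of the modulus. It is supplied for the cube of p, and
  -- again for p = 3 with modulus 9.
  module _ {m : ℤ} (F-unit : ∀ x → Unit m (F q x)) (F²≈ : ∀ x → F q x * F q x ≈ F q 0ℤ * F q 0ℤ [ m ]) where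

    -- Squaring `t-multiples` is what makes it usable: only the squares of the values of `F` are
    -- known to agree, and in V² and U² every such value occurs squared.
    t²-multiples : ∀ z j → t² (rep (P * z)) (j ℕ.* p) ≈ t² (rep z) j [ m ]
    t²-multiples z j = Unit-cancel {a = U * U} (Unit-* U-unit U-unit) (begin
      U * U * (T * T)           ≡⟨ lemma U T ⟩
      (U * T) * (U * T)         ≡⟨ cong (λ w → w * w) (t-multiples z j) ⟩
      (V * S) * (V * S)         ≡⟨ lemma V S ⟨
      V * V * (S * S)           ≈⟨ *-congʳ (S * S) V²≈U² ⟩
      U * U * (S * S)           ∎)
      where
      open ≈-Reasoning m
      T = t (rep (P * z)) (j ℕ.* p)
      S = t (rep z) j
      u v : ℕ → ℤ
      u l = F q (+ l) * F q (+ l)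
      v l = F q (z - + l - 1ℤ) * F q (z + + l)
      U = ∏ j u
      V = ∏ j v
      U-unit : Unit m U
      U-unit = ∏-Unit j λ l _ → Unit-* (F-unit (+ l)) (F-unit (+ l))
      lemma : ∀ u x → u * u * (x * x) ≡ (u * x) * (u * x)
      lemma = solve-∀
      F²F²≈ : ∀ x y → (F q x * F q y) * (F q x * F q y) ≈ (F q 0ℤ * F q 0ℤ) * (F q 0ℤ * F q 0ℤ) [ m ]
      F²F²≈ x y = ≈-trans (≈-reflexive (sym (lemma (F q x) (F q y)))) (*-cong (F²≈ x) (F²≈ y))
      V²≈U² : V * V ≈ U * U [ m ]
      V²≈U² = begin
        V * V                  ≡⟨ ∏-* j v v ⟨
        ∏ j (λ l → v l * v l)  ≈⟨ ∏-≈ j (λ l _ → ≈-trans (F²F²≈ (z - + l - 1ℤ) (z + + l)) (≈-sym (F²F²≈ (+ l) (+ l)))) ⟩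
        ∏ j (λ l → u l * u l)  ≡⟨ ∏-* j u u ⟩
        U * U                  ∎

    A-multiples : (∀ z j → ∑ q (λ i → t² (rep (P * z)) (j ℕ.* p ℕ.+ suc i)) ≈ 0ℤ [ m ]) →
      ∀ z → A (P * z) ≈ A z [ m ]
    A-multiples rest z = begin
      A (P * z)                     ≡⟨ A-rep (P * z) ⟩
      + apéryℕ (rep (P * z))     ≈⟨ apéryℕ-blocks q (rep (P * z)) (rep z) 1ℤ block ⟩
      1ℤ * + apéryℕ (rep z)      ≡⟨ ℤₚ.*-identityˡ _ ⟩
      + apéryℕ (rep z)           ≡⟨ A-rep z ⟨
      A z                           ∎
      where
      open ≈-Reasoning m
      block : ∀ j → ∑ p (λ i → t² (rep (P * z)) (j ℕ.* p ℕ.+ i)) ≈ 1ℤ * t² (rep z) j [ m ]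
      block j = begin
        t² (rep (P * z)) (j ℕ.* p ℕ.+ 0) + ∑ q (λ i → t² (rep (P * z)) (j ℕ.* p ℕ.+ suc i))
          ≈⟨ +-cong (≈-reflexive (cong (t² (rep (P * z))) (ℕₚ.+-identityʳ (j ℕ.* p)))) (rest z j) ⟩
        t² (rep (P * z)) (j ℕ.* p) + 0ℤ  ≡⟨ ℤₚ.+-identityʳ _ ⟩
        t² (rep (P * z)) (j ℕ.* p)       ≈⟨ t²-multiples z j ⟩
        t² (rep z) j                     ≡⟨ ℤₚ.*-identityˡ _ ⟨
        1ℤ * t² (rep z) j                ∎

-- Sums of inverse squares

∑-pairs : ∀ h f → ∑ (h ℕ.+ h) f ≡ ∑ h (λ i → f (i ℕ.+ i) + f (suc (i ℕ.+ i)))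
∑-pairs zero    f = refl
∑-pairs (suc h) f = begin
  ∑ (suc h ℕ.+ suc h) f                                    ≡⟨ cong (λ w → ∑ (suc w) f) (ℕₚ.+-suc h h) ⟩
  ∑ (suc (suc (h ℕ.+ h))) f                                ≡⟨ ∑-snoc (suc (h ℕ.+ h)) f ⟩
  ∑ (suc (h ℕ.+ h)) f + y                                  ≡⟨ cong (_+ y) (∑-snoc (h ℕ.+ h) f) ⟩
  ∑ (h ℕ.+ h) f + x + y                                    ≡⟨ ℤₚ.+-assoc (∑ (h ℕ.+ h) f) x y ⟩
  ∑ (h ℕ.+ h) f + (x + y)                                  ≡⟨ cong (_+ (x + y)) (∑-pairs h f) ⟩
  ∑ h (λ i → f (i ℕ.+ i) + f (suc (i ℕ.+ i))) + (x + y)    ≡⟨ ∑-snoc h (λ i → f (i ℕ.+ i) + f (suc (i ℕ.+ i))) ⟨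
  ∑ (suc h) (λ i → f (i ℕ.+ i) + f (suc (i ℕ.+ i)))        ∎
  where
  open ≡-Reasoning
  x = f (h ℕ.+ h)
  y = f (suc (h ℕ.+ h))

-- The entry y i belongs to the residue r = i + 1. Since r² y ≡ W, the value at r is 4 times
-- the value at 2r; as r ↦ 2r permutes the nonzero residues, 4 ∑ y ≡ ∑ y.
∑-inverse-squares : ∀ {m} h → let q = h ℕ.+ h in (∀ i → i ℕ.< q → Unit m (+ suc i)) → Unit m (+ 3) →
  ∀ W y → (∀ i → i ℕ.< q → + suc q * y i ≈ 0ℤ [ m ]) → (∀ i → i ℕ.< q → + suc i * + suc i * y i ≈ W [ m ]) →
  ∑ q y ≈ 0ℤ [ m ]
∑-inverse-squares {m} h unit 3-unit W y Py≈0 r²y≈W = Unit-cancel-0 3-unit (begin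
  + 3 * S                                              ≡⟨ lemma S ⟩
  + 4 * S + - 1ℤ * S                                   ≈⟨ +-cong 4S≈S (≈-refl {a = - 1ℤ * S}) ⟩
  S + - 1ℤ * S                                         ≡⟨ lemma′ S ⟩
  0ℤ                                                   ∎)
  where
  open ≈-Reasoning m
  q = h ℕ.+ h
  P = + suc q
  S = ∑ q y
  lemma : ∀ s → + 3 * s ≡ + 4 * s + - 1ℤ * s
  lemma = solve-∀
  lemma′ : ∀ s → s + - 1ℤ * s ≡ 0ℤ
  lemma′ = solve-∀
  -- Index 2i+1 stands for the residue 2(i+1), the exact double of the residue at index i.
  odd : ∀ i → i ℕ.< h → + 4 * y (suc (i ℕ.+ i)) ≈ y i [ m ]
  odd i i<h = Unit-cancel (Unit-* i-unit i-unit) (begin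
    + suc i * + suc i * (+ 4 * z)                   ≡⟨ double (+ i) z ⟩
    + suc (suc (i ℕ.+ i)) * + suc (suc (i ℕ.+ i)) * z ≈⟨ r²y≈W (suc (i ℕ.+ i)) (subst (ℕ._≤ q) (cong suc (ℕₚ.+-suc i i)) (ℕₚ.+-mono-≤ i<h i<h)) ⟩
    W                                               ≈⟨ r²y≈W i i<q ⟨
    + suc i * + suc i * y i                         ∎)
    where
    z = y (suc (i ℕ.+ i))
    i<q : i ℕ.< q
    i<q = ℕₚ.≤-trans i<h (ℕₚ.m≤m+n h h)
    i-unit = unit i i<q
    double : ∀ i z → (1ℤ + i) * (1ℤ + i) * (+ 4 * z) ≡ (1ℤ + (1ℤ + (i + i))) * (1ℤ + (1ℤ + (i + i))) * z
    double = solve-∀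
  -- Index 2i stands for s = 2i+1, and r = h+i+1 satisfies 2r = p + s. So 4r² exceeds s² by a
  -- multiple of p, which annihilates `y`.
  even : ∀ i → i ℕ.< h → + 4 * y (i ℕ.+ i) ≈ y (h ℕ.+ i) [ m ]
  even i i<h = Unit-cancel (Unit-* r-unit r-unit) (begin
    r * r * (+ 4 * z)                                   ≡⟨ double (+ h) (+ i) z ⟩
    s * s * z + (P + + 2 * s) * (P * z)                 ≈⟨ +-cong (r²y≈W (i ℕ.+ i) 2i<q) (*-zeroʳ-≈ (P + + 2 * s) (Py≈0 (i ℕ.+ i) 2i<q)) ⟩
    W + 0ℤ                                              ≡⟨ ℤₚ.+-identityʳ W ⟩
    W                                                   ≈⟨ r²y≈W (h ℕ.+ i) h+i<q ⟨
    r * r * y (h ℕ.+ i)                                 ∎)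
    where
    z = y (i ℕ.+ i)
    r = + suc (h ℕ.+ i)
    s = + suc (i ℕ.+ i)
    2i<q : i ℕ.+ i ℕ.< q
    2i<q = ℕₚ.+-mono-< i<h i<h
    h+i<q : h ℕ.+ i ℕ.< q
    h+i<q = ℕₚ.+-monoʳ-< h i<h
    r-unit = unit (h ℕ.+ i) h+i<q
    double : ∀ h i z → (1ℤ + (h + i)) * (1ℤ + (h + i)) * (+ 4 * z) ≡
      (1ℤ + (i + i)) * (1ℤ + (i + i)) * z +
      ((1ℤ + (h + h)) + + 2 * (1ℤ + (i + i))) * ((1ℤ + (h + h)) * z)
    double = solve-∀
  4S≈S : + 4 * S ≈ S [ m ]
  4S≈S = begin
    + 4 * S                                                            ≡⟨ ∑-*ˡ (+ 4) q y ⟨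
    ∑ q (λ i → + 4 * y i)                                              ≡⟨ ∑-pairs h (λ i → + 4 * y i) ⟩
    ∑ h (λ i → + 4 * y (i ℕ.+ i) + + 4 * y (suc (i ℕ.+ i)))            ≈⟨ ∑-≈ h (λ i i<h → +-cong (even i i<h) (odd i i<h)) ⟩
    ∑ h (λ i → y (h ℕ.+ i) + y i)                                      ≡⟨ ∑-+ h (λ i → y (h ℕ.+ i)) y ⟩
    ∑ h (λ i → y (h ℕ.+ i)) + ∑ h y                                    ≡⟨ ℤₚ.+-comm _ (∑ h y) ⟩
    ∑ h y + ∑ h (λ i → y (h ℕ.+ i))                                    ≡⟨ ∑-split h h y ⟨
    S                                                                  ∎

-- Finite choice: the inverses are collected into one function, so that they can be summed.
inverses : ∀ {m} n (f : ℕ → ℤ) → (∀ i → i ℕ.< n → Unit m (f i)) →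
  ∃ λ (v : ℕ → ℤ) → ∀ i → i ℕ.< n → f i * v i ≈ 1ℤ [ m ]
inverses zero    f u = f , λ _ ()
inverses {m} (suc n) f u with u 0 (s≤s z≤n) | inverses n (f ∘ suc) (λ i i<n → u (suc i) (s≤s i<n))
... | v₀ , fv₀≈1 | v , fv≈1 = v′ , fv′≈1
  where
  v′ : ℕ → ℤ
  v′ zero    = v₀
  v′ (suc i) = v i
  fv′≈1 : ∀ i → i ℕ.< suc n → f i * v′ i ≈ 1ℤ [ m ]
  fv′≈1 zero    _         = fv₀≈1
  fv′≈1 (suc i) (s≤s i<n) = fv≈1 i i<n

-- First-order expansion. An inverse modulo P suffices in w + P²X = w(1 + P²Xv), since the error
-- carries a third factor P; products of two corrections carry P⁴.
∏-perturb : ∀ P X n (w v : ℕ → ℤ) → (∀ i → i ℕ.< n → w i * v i ≈ 1ℤ [ P ]) →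
  ∏ n (λ i → w i + P * P * X) ≈ ∏ n w * (1ℤ + P * P * X * ∑ n v) [ P * (P * P) ]
∏-perturb P X zero    w v wv≈1 = ≈-reflexive (lemma (P * P * X))
  where
  lemma : ∀ y → 1ℤ ≡ 1ℤ * (1ℤ + y * 0ℤ)
  lemma = solve-∀
∏-perturb P X (suc n) w v wv≈1 with wv≈1 0 (s≤s z≤n)
... | c by eq = begin
  (w 0 + P * P * X) * ∏ n (λ i → w (suc i) + P * P * X)
    ≈⟨ *-cong first (∏-perturb P X n (w ∘ suc) (v ∘ suc) (λ i i<n → wv≈1 (suc i) (s≤s i<n))) ⟩
  w 0 * (1ℤ + P * P * X * v 0) * (∏ n (w ∘ suc) * (1ℤ + P * P * X * V))
    ≈⟨ (w 0 * ∏ n (w ∘ suc) * (P * X * X * v 0 * V)) by lemma₂ P X (w 0) (v 0) (∏ n (w ∘ suc)) V ⟩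
  w 0 * ∏ n (w ∘ suc) * (1ℤ + P * P * X * (v 0 + V))  ∎
  where
  open ≈-Reasoning (P * (P * P))
  V = ∑ n (v ∘ suc)
  first : w 0 + P * P * X ≈ w 0 * (1ℤ + P * P * X * v 0) [ P * (P * P) ]
  first = ≈-sym ((c * X) by trans (lemma P X (w 0) (v 0)) (trans (cong (λ y → w 0 + P * P * X * y) eq) (lemma′ P X (w 0) c)))
    where
    lemma : ∀ P X w v → w * (1ℤ + P * P * X * v) ≡ w + P * P * X * (w * v)
    lemma = solve-∀
    lemma′ : ∀ P X w c → w + P * P * X * (1ℤ + c * P) ≡ w + P * P * X + c * X * (P * (P * P))
    lemma′ = solve-∀
  lemma₂ : ∀ P X w v W V → w * (1ℤ + P * P * X * v) * (W * (1ℤ + P * P * X * V)) ≡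
    w * W * (1ℤ + P * P * X * (v + V)) + w * W * (P * X * X * v * V) * (P * (P * P))
  lemma₂ = solve-∀

-- The terms of the Apéry sum in a block

Unit-neg : ∀ {m a} → Unit m a → Unit m (- a)
Unit-neg {a = a} (v , av≈1) = - v , ≈-trans (≈-reflexive (lemma a v)) av≈1
  where
  lemma : ∀ a v → - a * - v ≡ a * v
  lemma = solve-∀

-- Primality enters only as the invertibility of 1, ..., p-1 modulo p, so p = 3 is covered as well.
module _ (q : ℕ) (unit : ∀ i → i ℕ.< q → Unit (+ suc q) (+ suc i)) where

  private
    p = suc q
    P = + p

  index≈ : ∀ j i → + suc (j ℕ.* p ℕ.+ i) ≈ + suc i [ P ]
  index≈ j i = + j by trans (cong (λ w → 1ℤ + w) (pos-index q j i)) (lemma P (+ j) (+ i))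
    where
    lemma : ∀ P j i → 1ℤ + (P * j + i) ≡ 1ℤ + i + j * P
    lemma = solve-∀

  index-unit : ∀ j i → i ℕ.< q → Unit P (+ suc (j ℕ.* p ℕ.+ i))
  index-unit j i i<q = Unit-resp (index≈ j i) (unit i i<q)

  F-Unit : ∀ x → Unit P (F q x)
  F-Unit x = ∏-Unit q λ i i<q → Unit-resp (x by lemma P x (+ suc i)) (unit i i<q)
    where
    lemma : ∀ P x s → P * x + s ≡ s + x * P
    lemma = solve-∀

  t-suc-block : ∀ z j i → let N = rep (P * z); k = j ℕ.* p ℕ.+ i in
    + suc k * + suc k * t N (j ℕ.* p ℕ.+ suc i) ≡ ((P * z) * (P * z + 1ℤ) - + k * + suc k) * t N k
  t-suc-block z j i =
    trans (cong (λ l → + suc k * + suc k * t (rep (P * z)) l) (ℕₚ.+-suc (j ℕ.* p) i))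
          (trans (t-suc-ℤ (P * z) k) (cong (λ w → ((P * z) * (P * z + 1ℤ) - + k * w) * t (rep (P * z)) k) (ℤₚ.+-comm (+ k) 1ℤ)))
    where
    k = j ℕ.* p ℕ.+ i

  -- The step out of k = p j has a factor divisible by p, and the later steps of the block divide by
  -- units only.
  t≈0 : ∀ z j i → i ℕ.< q → t (rep (P * z)) (j ℕ.* p ℕ.+ suc i) ≈ 0ℤ [ P ]
  t≈0 z j zero 0<q = Unit-cancel-0 (Unit-* (index-unit j 0 0<q) (index-unit j 0 0<q)) (begin
    s * s * t N (j ℕ.* p ℕ.+ 1)                             ≡⟨ t-suc-block z j 0 ⟩
    ((P * z) * (P * z + 1ℤ) - + k * s) * t N k              ≡⟨ cong (λ w → ((P * z) * (P * z + 1ℤ) - w * s) * t N k) (trans (pos-index q j 0) (ℤₚ.+-identityʳ (P * + j))) ⟩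
    ((P * z) * (P * z + 1ℤ) - P * + j * s) * t N k          ≡⟨ lemma P z (+ j) s (t N k) ⟩
    P * ((z * (P * z + 1ℤ) - + j * s) * t N k)              ≈⟨ multiple _ ⟩
    0ℤ                                                      ∎)
    where
    open ≈-Reasoning P
    N = rep (P * z)
    k = j ℕ.* p ℕ.+ 0
    s = + suc k
    lemma : ∀ P z j s x → ((P * z) * (P * z + 1ℤ) - P * j * s) * x ≡ P * ((z * (P * z + 1ℤ) - j * s) * x)
    lemma = solve-∀
  t≈0 z j (suc i) i<q = Unit-cancel-0 (Unit-* (index-unit j (suc i) i<q) (index-unit j (suc i) i<q))
    (≈-trans (≈-reflexive (t-suc-block z j (suc i))) (*-zeroʳ-≈ ((P * z) * (P * z + 1ℤ) - + k * + suc k) (t≈0 z j i (ℕₚ.<⇒≤ i<q))))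
    where
    k = j ℕ.* p ℕ.+ suc i

  t²≈0 : ∀ z j i → i ℕ.< q → t² (rep (P * z)) (j ℕ.* p ℕ.+ suc i) ≈ 0ℤ [ P * P ]
  t²≈0 z j i i<q = ≈0-*-≈0 (t≈0 z j i i<q) (t≈0 z j i i<q)

  -- Since p divides t, the summand p z (p z + 1) of the step factor contributes a multiple of p².
  -- What remains is -s s′, and one s′ cancels.
  t-suc-mod-P² : ∀ z j i → suc i ℕ.< q →
    + suc (j ℕ.* p ℕ.+ suc i) * t (rep (P * z)) (j ℕ.* p ℕ.+ suc (suc i)) ≈
    - (+ suc (j ℕ.* p ℕ.+ i) * t (rep (P * z)) (j ℕ.* p ℕ.+ suc i)) [ P * P ]
  t-suc-mod-P² z j i i<q = Unit-cancel (Unit-mod-* s′-unit s′-unit) (begin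
    s′ * (s′ * t N (j ℕ.* p ℕ.+ suc (suc i)))           ≡⟨ ℤₚ.*-assoc s′ s′ _ ⟨
    s′ * s′ * t N (j ℕ.* p ℕ.+ suc (suc i))             ≡⟨ t-suc-block z j (suc i) ⟩
    ((P * z) * (P * z + 1ℤ) - + k * s′) * x             ≡⟨ cong (λ w → ((P * z) * (P * z + 1ℤ) - w * s′) * x) (cong +_ (ℕₚ.+-suc (j ℕ.* p) i)) ⟩
    ((P * z) * (P * z + 1ℤ) - s * s′) * x               ≡⟨ lemma P z s s′ x ⟩
    s′ * - (s * x) + (P * (z * (P * z + 1ℤ))) * x       ≈⟨ +-≈0ʳ (s′ * - (s * x)) (≈0-*-≈0 {P} {P} (multiple (z * (P * z + 1ℤ))) (t≈0 z j i (ℕₚ.<⇒≤ i<q))) ⟩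
    s′ * - (s * x)                                      ∎)
    where
    open ≈-Reasoning (P * P)
    N = rep (P * z)
    k = j ℕ.* p ℕ.+ suc i
    s = + suc (j ℕ.* p ℕ.+ i)
    s′ = + suc (j ℕ.* p ℕ.+ suc i)
    s′-unit = index-unit j (suc i) i<q
    x = t N (j ℕ.* p ℕ.+ suc i)
    lemma : ∀ P z s s′ x → ((P * z) * (P * z + 1ℤ) - s * s′) * x ≡ s′ * - (s * x) + (P * (z * (P * z + 1ℤ))) * x
    lemma = solve-∀

  -- Squaring gains one power of P: with b = lP and a = -b + kP², the cross term is a multiple of
  -- P³.
  sq-lift : ∀ {a b} → a ≈ - b [ P * P ] → b ≈ 0ℤ [ P ] → a * a ≈ b * b [ P * (P * P) ]
  sq-lift (k by refl) (l by refl) = (- (k * l * + 2) + k * k * P) by lemma P k l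
    where
    lemma : ∀ P k l → (- (0ℤ + l * P) + k * (P * P)) * (- (0ℤ + l * P) + k * (P * P)) ≡
      (0ℤ + l * P) * (0ℤ + l * P) + (- (k * l * + 2) + k * k * P) * (P * (P * P))
    lemma = solve-∀

  r²t²-constant : ∀ z j → let x = λ i → t (rep (P * z)) (j ℕ.* p ℕ.+ suc i); s = λ i → + suc (j ℕ.* p ℕ.+ i) in
    ∀ i → i ℕ.< q → (s i * x i) * (s i * x i) ≈ (s 0 * x 0) * (s 0 * x 0) [ P * (P * P) ]
  r²t²-constant z j zero    _   = ≈-refl
  r²t²-constant z j (suc i) i<q = ≈-trans
    (sq-lift (t-suc-mod-P² z j i i<q) (*-zeroʳ-≈ (+ suc (j ℕ.* p ℕ.+ i)) (t≈0 z j i (ℕₚ.<⇒≤ i<q))))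
    (r²t²-constant z j i (ℕₚ.<⇒≤ i<q))

-- The supercongruence modulo the cube of p

module _ (h : ℕ) where

  private
    q = h ℕ.+ h
    p = suc q
    P = + p

  module _ (unit : ∀ i → i ℕ.< q → Unit P (+ suc i)) (3-unit : Unit P (+ 3)) where

    Unit-P³ : ∀ {a} → Unit P a → Unit (P * (P * P)) a
    Unit-P³ u = Unit-mod-* u (Unit-mod-* u u)

    private
      w : ℕ → ℤ
      w i = + suc i * (P - + suc i)

    -- As t² is a multiple of p², the factor (p j + r)² may be replaced by r² modulo p³; then r² t²
    -- is constant on the block and the sum is one of inverse squares.
    ∑-t²≈0 : ∀ z j → ∑ q (λ i → t² (rep (P * z)) (j ℕ.* p ℕ.+ suc i)) ≈ 0ℤ [ P * (P * P) ]
    ∑-t²≈0 z j = ∑-inverse-squares h (λ i i<q → Unit-P³ (unit i i<q)) (Unit-P³ 3-unit)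
      ((s 0 * x 0) * (s 0 * x 0)) (λ i → x i * x i) P*y≈0
      λ i i<q → ≈-trans (≈-sym (shift i i<q)) (r²t²-constant q unit z j i i<q)
      where
      x s : ℕ → ℤ
      x i = t (rep (P * z)) (j ℕ.* p ℕ.+ suc i)
      s i = + suc (j ℕ.* p ℕ.+ i)
      P*y≈0 : ∀ i → i ℕ.< q → P * (x i * x i) ≈ 0ℤ [ P * (P * P) ]
      P*y≈0 i i<q = ≈0-*-≈0 {P} {P * P} modulus≈0 (t²≈0 q unit z j i i<q)
      shift : ∀ i → i ℕ.< q → (s i * x i) * (s i * x i) ≈ + suc i * + suc i * (x i * x i) [ P * (P * P) ]
      shift i i<q with index≈ q unit j i
      ... | c by eq = begin
        (s i * x i) * (s i * x i)                                ≡⟨ cong (λ w → (w * x i) * (w * x i)) eq ⟩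
        ((r + c * P) * x i) * ((r + c * P) * x i)                ≡⟨ lemma P r c (x i) ⟩
        r * r * (x i * x i) + (c * (+ 2 * r + c * P)) * (P * (x i * x i)) ≈⟨ +-≈0ʳ (r * r * (x i * x i)) (*-zeroʳ-≈ (c * (+ 2 * r + c * P)) (P*y≈0 i i<q)) ⟩
        r * r * (x i * x i)                                      ∎
        where
        open ≈-Reasoning (P * (P * P))
        r = + suc i
        lemma : ∀ P r c x → ((r + c * P) * x) * ((r + c * P) * x) ≡
          r * r * (x * x) + (c * (+ 2 * r + c * P)) * (P * (x * x))
        lemma = solve-∀

    -- By pairing the factors for r and p - r.
    F²≈∏ : ∀ x → F q x * F q x ≈ ∏ q w [ P * (P * P) ]
    F²≈∏ x with inverses q w w-unit
      where
      w-unit : ∀ i → i ℕ.< q → Unit P (w i)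
      w-unit i i<q = Unit-* (unit i i<q) (Unit-resp (1ℤ by lemma P (+ suc i)) (Unit-neg (unit i i<q)))
        where
        lemma : ∀ P s → P - s ≡ - s + 1ℤ * P
        lemma = solve-∀
    ... | v , wv≈1 = begin
      F q x * F q x                                       ≡⟨ cong (F q x *_) (trans (F-reverse q (x + 1ℤ)) (cong (F q) (cancel x))) ⟨
      F q x * ∏ q (λ i → P * (x + 1ℤ) - + suc i)          ≡⟨ ∏-* q (λ i → P * x + + suc i) (λ i → P * (x + 1ℤ) - + suc i) ⟨
      ∏ q (λ i → (P * x + + suc i) * (P * (x + 1ℤ) - + suc i)) ≡⟨ ∏-cong q (λ i → pair P x (+ suc i)) ⟩
      ∏ q (λ i → w i + P * P * X)                         ≈⟨ ∏-perturb P X q w v wv≈1 ⟩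
      ∏ q w * (1ℤ + P * P * X * ∑ q v)                    ≡⟨ lemma P X (∏ q w) (∑ q v) ⟩
      -- The correction already carries P², so it is enough that `∑ q v` vanishes modulo P.
      ∏ q w + ∏ q w * X * (∑ q v * (P * P))               ≈⟨ +-≈0ʳ (∏ q w) (*-zeroʳ-≈ (∏ q w * X) (≈0-*-≈0 {P} {P * P} ∑v≈0 modulus≈0)) ⟩
      ∏ q w                                               ∎
      where
      open ≈-Reasoning (P * (P * P))
      X = x * (x + 1ℤ)
      cancel : ∀ x → x + 1ℤ - 1ℤ ≡ x
      cancel = solve-∀
      pair : ∀ P x s → (P * x + s) * (P * (x + 1ℤ) - s) ≡ s * (P - s) + P * P * (x * (x + 1ℤ))
      pair = solve-∀
      lemma : ∀ P X W V → W * (1ℤ + P * P * X * V) ≡ W + W * X * (V * (P * P))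
      lemma = solve-∀
      ∑v≈0 : ∑ q v ≈ 0ℤ [ P ]
      -- Modulo P, v is the inverse of r(p-r), that is of -r²; hence the constant -1.
      ∑v≈0 = ∑-inverse-squares h unit 3-unit (- 1ℤ) v (λ i _ → multiple (v i)) λ i i<q →
        ≈-trans ((v i * + suc i) by s²v P (+ suc i) (v i)) (*-congˡ (- 1ℤ) (wv≈1 i i<q))
        where
        s²v : ∀ P s v → s * s * v ≡ - 1ℤ * (s * (P - s) * v) + v * s * P
        s²v = solve-∀

    A-supercongruence : ∀ z → A (P * z) ≈ A z [ P * (P * P) ]
    A-supercongruence = A-multiples q (λ x → Unit-P³ (F-Unit q unit x))
      (λ x → ≈-trans (F²≈∏ x) (≈-sym (F²≈∏ 0ℤ))) ∑-t²≈0

-- Application to primes from 5 on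

parity : ∀ n → ∃ λ h → n ≡ h ℕ.+ h ⊎ n ≡ suc (h ℕ.+ h)
parity zero    = 0 , inj₁ refl
parity (suc n) with parity n
... | h , inj₁ refl = h , inj₂ refl
... | h , inj₂ refl = suc h , inj₁ (cong suc (sym (ℕₚ.+-suc h h)))

odd-prime : ∀ {p} → Prime p → p ≥ 5 → ∃ λ h → p ≡ suc (h ℕ.+ h)
odd-prime {p} p-prime p≥5 with parity p
... | h , inj₂ p≡1+2h = h , p≡1+2h
-- An even p has the divisor 2, so irreducibility forces 2 = p, against p ≥ 5.
... | h , inj₁ refl with prime⇒irreducible p-prime (ℕ-divides h (lemma h))
  where
  lemma : ∀ h → h ℕ.+ h ≡ h ℕ.* 2
  lemma = ℕ-Solver.solve-∀
... | inj₂ 2≡p = ⊥-elim (ℕₚ.<⇒≢ (ℕₚ.≤-trans (s≤s (s≤s (s≤s z≤n))) p≥5) 2≡p)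

A-prime : ∀ {p} → Prime p → p ≥ 5 → ∀ z → A (+ p * z) ≈ A z [ + (p ℕ.^ 3) ]
A-prime {p} p-prime p≥5 z with odd-prime p-prime p≥5
... | h , refl = subst (A (P * z) ≈ A z [_]) P³≡ (A-supercongruence h unit 3-unit z)
  where
  P = + suc (h ℕ.+ h)
  unit : ∀ i → i ℕ.< h ℕ.+ h → Unit P (+ suc i)
  unit i i<q = prime⇒Unit p-prime (suc i) (s≤s i<q)
  3-unit : Unit P (+ 3)
  3-unit = prime⇒Unit p-prime 3 (ℕₚ.≤-trans (s≤s (s≤s (s≤s (s≤s z≤n)))) p≥5)
  P³≡ : P * (P * P) ≡ + (p ℕ.^ 3)
  P³≡ = trans (cong (P *_) (sym (ℤₚ.pos-* p p))) (trans (sym (ℤₚ.pos-* p (p ℕ.* p))) (cong (λ w → + (p ℕ.* (p ℕ.* w))) (sym (ℕₚ.*-identityʳ p))))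

-- The congruence modulo 9

unit-mod-3 : ∀ i → i ℕ.< 2 → Unit (+ 3) (+ suc i)
unit-mod-3 0 _ = 1ℤ , ≈-refl
unit-mod-3 1 _ = + 2 , (1ℤ by refl)
unit-mod-3 (suc (suc _)) (s≤s (s≤s ()))

Unit-mod-9 : ∀ j i → i ℕ.< 2 → Unit (+ 9) (+ suc i + + 3 * + j)
Unit-mod-9 j i i<2 = Unit-mod-* u u
  where
  u : Unit (+ 3) (+ suc i + + 3 * + j)
  u = Unit-resp (+-≈0ʳ (+ suc i) (multiple (+ j))) (unit-mod-3 i i<2)

-- For p = 3 the modulus is only p², so the terms away from multiples of 3 vanish one by one.
A-triple : ∀ z → A (+ 3 * z) ≈ A z [ + 9 ]
A-triple = A-multiples 2 (λ x → let u = F-Unit 2 unit-mod-3 x in Unit-mod-* u u) F²≈F0² λ z j →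
  ≈-trans (∑-≈ 2 (t²≈0 2 unit-mod-3 z j)) (≈-reflexive (∑-zero 2))
  where
  F²≈F0² : ∀ x → F 2 x * F 2 x ≈ F 2 0ℤ * F 2 0ℤ [ + 9 ]
  -- Here F(x) = (3x+1)(3x+2) = 2 + 9x(x+1).
  F²≈F0² x = (x * (x + 1ℤ) * (+ 4 + + 9 * (x * (x + 1ℤ)))) by lemma x
    where
    lemma : ∀ x → ((+ 3 * x + + 1) * ((+ 3 * x + + 2) * 1ℤ)) * ((+ 3 * x + + 1) * ((+ 3 * x + + 2) * 1ℤ)) ≡
      + 4 + x * (x + 1ℤ) * (+ 4 + + 9 * (x * (x + 1ℤ))) * + 9
    lemma = solve-∀

-- Arguments congruent to 1 modulo 3

module _ (z : ℤ) where

  private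
    N = rep (1ℤ + + 3 * z)
    X = z * (z + 1ℤ)
    s₁ s₂ c d u v : ℕ → ℤ
    s₁ j = + 1 + + 3 * + j
    s₂ j = + 2 + + 3 * + j
    c j = + 9 * (+ suc j * + suc j)
    d j = + 9 * (X - + j * (+ j + 1ℤ))
    u j = (s₁ j * s₁ j) * (s₂ j * s₂ j)
    v j = (+ 2 + + 9 * X - + 3 * + j * s₁ j) * (+ 2 + + 9 * X - s₂ j * (+ 3 + + 3 * + j))
    T₀ T₁ T₂ : ℕ → ℤ
    T₀ j = t N (j ℕ.* 3)
    T₁ j = t N (1 ℕ.+ j ℕ.* 3)
    T₂ j = t N (2 ℕ.+ j ℕ.* 3)

  -- At y = 1 + 3z the product y(y+1) equals 2 + 9X.
  t-suc-triple : ∀ j i → let s = + 1 + (+ i + + 3 * + j) in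
    s * s * t N (suc i ℕ.+ j ℕ.* 3) ≡ (+ 2 + + 9 * X - (+ i + + 3 * + j) * s) * t N (i ℕ.+ j ℕ.* 3)
  t-suc-triple j i = begin
    s * s * t N (suc (i ℕ.+ j ℕ.* 3))                            ≡⟨ cong (λ w → (1ℤ + w) * (1ℤ + w) * t N (suc k)) pos-k ⟨
    + suc k * + suc k * t N (suc k)                              ≡⟨ t-suc-ℤ y k ⟩
    (y * (y + 1ℤ) - + k * (+ k + 1ℤ)) * t N k                    ≡⟨ cong (λ w → (y * (y + 1ℤ) - w * (w + 1ℤ)) * t N k) pos-k ⟩
    (y * (y + 1ℤ) - l * (l + 1ℤ)) * t N k                        ≡⟨ lemma z l (t N k) ⟩
    (+ 2 + + 9 * X - l * s) * t N k                              ∎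
    where
    open ≡-Reasoning
    k = i ℕ.+ j ℕ.* 3
    l = + i + + 3 * + j
    s = 1ℤ + l
    y = 1ℤ + + 3 * z
    pos-k : + k ≡ l
    pos-k = cong (λ w → + i + w) (trans (ℤₚ.pos-* j 3) (ℤₚ.*-comm (+ j) (+ 3)))
    lemma : ∀ z l x → ((1ℤ + + 3 * z) * ((1ℤ + + 3 * z) + 1ℤ) - l * (l + 1ℤ)) * x ≡
      (+ 2 + + 9 * (z * (z + 1ℤ)) - l * (1ℤ + l)) * x
    lemma = solve-∀

  T₀-step : ∀ j → s₁ j * s₁ j * T₁ j ≡ (+ 2 + + 9 * X - + 3 * + j * s₁ j) * T₀ j
  T₀-step j = trans (lemma (+ j) (T₁ j)) (trans (t-suc-triple j 0) (lemma′ (+ j) X (T₀ j)))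
    where
    lemma : ∀ j x → (+ 1 + + 3 * j) * (+ 1 + + 3 * j) * x ≡ (+ 1 + (+ 0 + + 3 * j)) * (+ 1 + (+ 0 + + 3 * j)) * x
    lemma = solve-∀
    lemma′ : ∀ j X x → (+ 2 + + 9 * X - (+ 0 + + 3 * j) * (+ 1 + (+ 0 + + 3 * j))) * x ≡
      (+ 2 + + 9 * X - + 3 * j * (+ 1 + + 3 * j)) * x
    lemma′ = solve-∀

  -- The index 3j+1 has l(l+1) = 2 + 9j(j+1), so the constant 2 cancels and 9 times the step factor
  -- for z is left.
  T₁-step : ∀ j → s₂ j * s₂ j * T₂ j ≡ d j * T₁ j
  T₁-step j = trans (lemma (+ j) (T₂ j)) (trans (t-suc-triple j 1) (lemma′ (+ j) X (T₁ j)))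
    where
    lemma : ∀ j x → (+ 2 + + 3 * j) * (+ 2 + + 3 * j) * x ≡ (+ 1 + (+ 1 + + 3 * j)) * (+ 1 + (+ 1 + + 3 * j)) * x
    lemma = solve-∀
    lemma′ : ∀ j X x → (+ 2 + + 9 * X - (+ 1 + + 3 * j) * (+ 1 + (+ 1 + + 3 * j))) * x ≡
      + 9 * (X - j * (j + 1ℤ)) * x
    lemma′ = solve-∀

  T₂-step : ∀ j → c j * T₀ (suc j) ≡ (+ 2 + + 9 * X - s₂ j * (+ 3 + + 3 * + j)) * T₂ j
  T₂-step j = trans (lemma (+ j) (T₀ (suc j))) (trans (t-suc-triple j 2) (lemma′ (+ j) X (T₂ j)))
    where
    lemma : ∀ j x → + 9 * ((1ℤ + j) * (1ℤ + j)) * x ≡ (+ 1 + (+ 2 + + 3 * j)) * (+ 1 + (+ 2 + + 3 * j)) * x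
    lemma = solve-∀
    lemma′ : ∀ j X x → (+ 2 + + 9 * X - (+ 2 + + 3 * j) * (+ 1 + (+ 2 + + 3 * j))) * x ≡
      (+ 2 + + 9 * X - (+ 2 + + 3 * j) * (+ 3 + + 3 * j)) * x
    lemma′ = solve-∀

  -- Over three steps, `c` and `d` are 9 times the two coefficients of the recurrence for z; `u` and
  -- `v` gather the remaining factors.
  T₀-comparison : ∀ j → ∏ j u * T₀ j ≡ ∏ j v * t (rep z) j
  T₀-comparison = compare-∏ c d u v T₀ (t (rep z)) (λ _ → _) step
    (λ j → trans (lemma (+ suc j * + suc j) (t (rep z) (suc j)))
      (trans (cong (+ 9 *_) (t-suc-ℤ z j)) (sym (ℤₚ.*-assoc (+ 9) (X - + j * (+ j + 1ℤ)) (t (rep z) j))))) refl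
    where
    lemma : ∀ s x → + 9 * s * x ≡ + 9 * (s * x)
    lemma = solve-∀
    step : ∀ j → c j * u j * T₀ (suc j) ≡ d j * v j * T₀ j
    step j = begin
      c j * (a * b) * T₀ (suc j)     ≡⟨ lemma₁ (c j) a b (T₀ (suc j)) ⟩
      a * (b * (c j * T₀ (suc j)))   ≡⟨ cong (λ w → a * (b * w)) (T₂-step j) ⟩
      a * (b * (q₂ * T₂ j))          ≡⟨ lemma₂ a b q₂ (T₂ j) ⟩
      a * (q₂ * (b * T₂ j))          ≡⟨ cong (λ w → a * (q₂ * w)) (T₁-step j) ⟩
      a * (q₂ * (d j * T₁ j))        ≡⟨ lemma₃ a q₂ (d j) (T₁ j) ⟩
      q₂ * (d j * (a * T₁ j))        ≡⟨ cong (λ w → q₂ * (d j * w)) (T₀-step j) ⟩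
      q₂ * (d j * (q₀ * T₀ j))       ≡⟨ lemma₄ q₂ (d j) q₀ (T₀ j) ⟩
      d j * (q₀ * q₂) * T₀ j         ∎
      where
      open ≡-Reasoning
      a = s₁ j * s₁ j
      b = s₂ j * s₂ j
      q₀ = + 2 + + 9 * X - + 3 * + j * s₁ j
      q₂ = + 2 + + 9 * X - s₂ j * (+ 3 + + 3 * + j)
      lemma₁ : ∀ c a b x → c * (a * b) * x ≡ a * (b * (c * x))
      lemma₁ = solve-∀
      lemma₂ : ∀ a b q x → a * (b * (q * x)) ≡ a * (q * (b * x))
      lemma₂ = solve-∀
      lemma₃ : ∀ a q d x → a * (q * (d * x)) ≡ q * (d * (a * x))
      lemma₃ = solve-∀
      lemma₄ : ∀ q d r x → q * (d * (r * x)) ≡ d * (r * q) * x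
      lemma₄ = solve-∀

  u≈4 : ∀ j → u j ≈ + 4 [ + 9 ]
  u≈4 j = ((+ j + + j * + j) * (+ 4 + + 9 * (+ j + + j * + j))) by lemma (+ j)
    where
    lemma : ∀ j → ((+ 1 + + 3 * j) * (+ 1 + + 3 * j)) * ((+ 2 + + 3 * j) * (+ 2 + + 3 * j)) ≡
      + 4 + (j + j * j) * (+ 4 + + 9 * (j + j * j)) * + 9
    lemma = solve-∀

  -- Modulo 9 the two factors are 2 - 3j and 5 + 3j, with product 10 - 9j - 9j².
  v≈1 : ∀ j → v j ≈ 1ℤ [ + 9 ]
  v≈1 j = (- 1ℤ - + 2 * + j + + 5 * (+ j * + j) - y * (+ 2 + + 18 * + j) + + 9 * (y * y)) by lemma (+ j) X
    where
    y = X - + j * + j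
    lemma : ∀ j X → (+ 2 + + 9 * X - + 3 * j * (+ 1 + + 3 * j)) * (+ 2 + + 9 * X - (+ 2 + + 3 * j) * (+ 3 + + 3 * j)) ≡
      1ℤ + (- 1ℤ - + 2 * j + + 5 * (j * j) - (X - j * j) * (+ 2 + + 18 * j) + + 9 * ((X - j * j) * (X - j * j))) * + 9
    lemma = solve-∀

  ∏v≈1 : ∀ j → ∏ j v ≈ 1ℤ [ + 9 ]
  ∏v≈1 zero    = ≈-refl
  ∏v≈1 (suc j) = ≈-trans (≈-reflexive (∏-snoc j v)) (*-cong (∏v≈1 j) (v≈1 j))

  -- Each u² is 7 modulo 9, and 7^j = (1+6)^j is 1 + 6j. The result is the weight of the block sum.
  5∏u² : ∀ j → + 5 * (∏ j u * ∏ j u) ≈ + 5 + + 3 * + j [ + 9 ]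
  5∏u² zero    = ≈-refl
  5∏u² (suc j) = begin
    + 5 * (∏ (suc j) u * ∏ (suc j) u)       ≡⟨ cong (λ w → + 5 * (w * w)) (∏-snoc j u) ⟩
    + 5 * (∏ j u * u j * (∏ j u * u j))     ≡⟨ lemma (∏ j u) (u j) ⟩
    + 5 * (∏ j u * ∏ j u) * (u j * u j)     ≈⟨ *-cong (5∏u² j) (sq-cong (u≈4 j)) ⟩
    (+ 5 + + 3 * + j) * (+ 4 * + 4)         ≈⟨ (+ 8 + + 5 * + j) by lemma′ (+ j) ⟩
    + 5 + + 3 * + suc j                     ∎
    where
    open ≈-Reasoning (+ 9)
    lemma : ∀ U u → + 5 * (U * u * (U * u)) ≡ + 5 * (U * U) * (u * u)
    lemma = solve-∀
    lemma′ : ∀ j → (+ 5 + + 3 * j) * (+ 4 * + 4) ≡ + 5 + + 3 * (1ℤ + j) + (+ 8 + + 5 * j) * + 9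
    lemma′ = solve-∀

  T₀² : ∀ j → (+ 5 + + 3 * + j) * (T₀ j * T₀ j) ≈ + 5 * t² (rep z) j [ + 9 ]
  T₀² j = Unit-cancel (Unit-* U-unit U-unit) (begin
    U * U * (r * (T₀ j * T₀ j))     ≡⟨ lemma U r (T₀ j) ⟩
    r * ((U * T₀ j) * (U * T₀ j))   ≡⟨ cong (λ w → r * (w * w)) (T₀-comparison j) ⟩
    r * ((V * S) * (V * S))         ≈⟨ *-congˡ r (sq-cong (*-congʳ S (∏v≈1 j))) ⟩
    r * ((1ℤ * S) * (1ℤ * S))       ≡⟨ cong (λ w → r * (w * w)) (ℤₚ.*-identityˡ S) ⟩
    r * (S * S)                     ≈⟨ *-congʳ (S * S) (5∏u² j) ⟨
    + 5 * (U * U) * (S * S)         ≡⟨ lemma′ U S ⟩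
    U * U * (+ 5 * (S * S))         ∎)
    where
    open ≈-Reasoning (+ 9)
    U = ∏ j u
    V = ∏ j v
    S = t (rep z) j
    r = + 5 + + 3 * + j
    U-unit : Unit (+ 9) U
    -- The inverse of 4 is 7, as 28 = 1 + 3 * 9.
    U-unit = ∏-Unit j λ l _ → Unit-resp (u≈4 l) (+ 7 , (+ 3 by refl))
    lemma : ∀ U r T → U * U * (r * (T * T)) ≡ r * ((U * T) * (U * T))
    lemma = solve-∀
    lemma′ : ∀ U S → + 5 * (U * U) * (S * S) ≡ U * U * (+ 5 * (S * S))
    lemma′ = solve-∀

  -- Modulo 9 the inverse of (1+3j)² is 1 + 3j, and (2-3j)(1+3j) is 2 - 6j.
  T₁≈ : ∀ j → T₁ j ≈ + 2 * (1ℤ - + 3 * + j) * T₀ j [ + 9 ]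
  T₁≈ j = Unit-cancel (Unit-* s-unit s-unit) (≈-trans (≈-reflexive (T₀-step j))
    (((X + (+ 6 * + j * + j * + j + + j * + j - + j)) * T₀ j) by lemma (+ j) X (T₀ j)))
    where
    s-unit = Unit-mod-9 j 0 (s≤s z≤n)
    lemma : ∀ j X x → (+ 2 + + 9 * X - + 3 * j * (+ 1 + + 3 * j)) * x ≡
      (+ 1 + + 3 * j) * (+ 1 + + 3 * j) * (+ 2 * (1ℤ - + 3 * j) * x) +
      (X + (+ 6 * j * j * j + j * j - j)) * x * + 9
    lemma = solve-∀

  T₂≈0 : ∀ j → T₂ j ≈ 0ℤ [ + 9 ]
  T₂≈0 j = Unit-cancel-0 (Unit-* s-unit s-unit) (≈-trans (≈-reflexive (T₁-step j))
    (*-zeroˡ-≈ (T₁ j) (multiple (X - + j * (+ j + 1ℤ)))))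
    where
    s-unit = Unit-mod-9 j 1 (s≤s (s≤s z≤n))

  triple-block : ∀ j → ∑ 3 (λ i → t² N (j ℕ.* 3 ℕ.+ i)) ≈ + 5 * t² (rep z) j [ + 9 ]
  triple-block j = begin
    ∑ 3 (λ i → t² N (j ℕ.* 3 ℕ.+ i))                            ≡⟨ ∑-cong 3 (λ i → cong (t² N) (ℕₚ.+-comm (j ℕ.* 3) i)) ⟩
    x * x + (T₁ j * T₁ j + (T₂ j * T₂ j + 0ℤ))                  ≈⟨ +-cong (≈-refl {a = x * x}) (+-cong (sq-cong (T₁≈ j)) (+-cong (sq-cong (T₂≈0 j)) (≈-refl {a = 0ℤ}))) ⟩
    -- The weight is 1 + 4(1-3j)² = 5 - 24j + 36j².
    x * x + (y * y + (0ℤ * 0ℤ + 0ℤ))                            ≈⟨ ((+ 4 * + j * + j - + 3 * + j) * (x * x)) by lemma (+ j) x ⟩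
    (+ 5 + + 3 * + j) * (x * x)                                 ≈⟨ T₀² j ⟩
    + 5 * t² (rep z) j                                       ∎
    where
    open ≈-Reasoning (+ 9)
    x = T₀ j
    y = + 2 * (1ℤ - + 3 * + j) * x
    lemma : ∀ j x → x * x + ((+ 2 * (1ℤ - + 3 * j) * x) * (+ 2 * (1ℤ - + 3 * j) * x) + (0ℤ * 0ℤ + 0ℤ)) ≡
      (+ 5 + + 3 * j) * (x * x) + (+ 4 * j * j - + 3 * j) * (x * x) * + 9
    lemma = solve-∀

  A-triple-suc : A (1ℤ + + 3 * z) ≈ + 5 * A z [ + 9 ]
  A-triple-suc = subst₂ (λ x y → x ≈ + 5 * y [ + 9 ]) (sym (A-rep (1ℤ + + 3 * z))) (sym (A-rep z))
    (apéryℕ-blocks 2 N (rep z) (+ 5) triple-block)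

-- Residue classes modulo 3, reflection for primes, and assembly

A-residue : ∀ d → d ℕ.< 3 → ∀ n → A (+ d + + 3 * n) ≈ A (+ d) * A n [ + 9 ]
A-residue 0 _ n = begin
  A (0ℤ + + 3 * n)  ≡⟨ cong A (ℤₚ.+-identityˡ (+ 3 * n)) ⟩
  A (+ 3 * n)       ≈⟨ A-triple n ⟩
  A n               ≡⟨ ℤₚ.*-identityˡ (A n) ⟨
  1ℤ * A n          ∎
  where open ≈-Reasoning (+ 9)
-- `A (+ 1)` evaluates to 5.
A-residue 1 _ n = A-triple-suc n
A-residue 2 _ n = begin
  A (+ 2 + + 3 * n)               ≡⟨ cong A (lemma n) ⟩
  A (- 1ℤ - + 3 * (- 1ℤ - n))     ≡⟨ A-reflect (+ 3 * (- 1ℤ - n)) ⟩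
  A (+ 3 * (- 1ℤ - n))            ≈⟨ A-triple (- 1ℤ - n) ⟩
  A (- 1ℤ - n)                    ≡⟨ A-reflect n ⟩
  -- `A (+ 2)` evaluates to 73 = 1 + 8 * 9.
  A n                             ≈⟨ (- (+ 8 * A n)) by lemma′ (A n) ⟩
  + 73 * A n                      ∎
  where
  open ≈-Reasoning (+ 9)
  lemma : ∀ n → + 2 + + 3 * n ≡ - 1ℤ - + 3 * (- 1ℤ - n)
  lemma = solve-∀
  lemma′ : ∀ x → x ≡ + 73 * x + - (+ 8 * x) * + 9
  lemma′ = solve-∀
A-residue (suc (suc (suc _))) (s≤s (s≤s (s≤s ())))

A-prime-reflected : ∀ {p} → Prime p → p ≥ 5 → ∀ n → A n ≈ A (+ p * n + + p - + 1) [ + (p ℕ.^ 3) ]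
A-prime-reflected {p} p-prime p≥5 n = begin
  A n                                ≡⟨ A-reflect n ⟨
  A (- 1ℤ - n)                       ≈⟨ A-prime p-prime p≥5 (- 1ℤ - n) ⟨
  A (+ p * (- 1ℤ - n))               ≡⟨ A-reflect (+ p * (- 1ℤ - n)) ⟨
  A (- 1ℤ - + p * (- 1ℤ - n))        ≡⟨ cong A (lemma (+ p) n) ⟩
  A (+ p * n + + p - + 1)            ∎
  where
  open ≈-Reasoning (+ (p ℕ.^ 3))
  lemma : ∀ p n → - 1ℤ - p * (- 1ℤ - n) ≡ p * n + p - + 1
  lemma = solve-∀

theorem5 : ((∀ (n : ℕ) → A (+ n) ≡ (+ 5) ^ n [mod 8 ])
    × (∀ (m : ℕ) → ((+ 5) ^ m) * A -[1+ m ] ≡ + 1 [mod 8 ]))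
    × (∀ (d : ℕ) → d ℕ.< 3 → ∀ (n : ℤ) → A (+ d + (+ 3) * n) ≡ A (+ d) * A n [mod 9 ])
    × (∀ (p : ℕ) → Prime p → p ≥ 5 → ∀ (n : ℤ) →
    (A ((+ p) * n) ≡ A n [mod p ℕ.^ 3 ])
    × (A n ≡ A ((+ p) * n + (+ p) - (+ 1)) [mod p ℕ.^ 3 ]))
theorem5 =
  ((λ n → ≈⇒≡[mod] 8 (apéryℕ≈5^n n)) , (λ m → ≈⇒≡[mod] 8 (5^n*apéryℕ≈1 m))) ,
  (λ d d<3 n → ≈⇒≡[mod] 9 (A-residue d d<3 n)) ,
  λ p p-prime p≥5 n →
    ≈⇒≡[mod] (p ℕ.^ 3) (A-prime p-prime p≥5 n) ,
    ≈⇒≡[mod] (p ℕ.^ 3) (A-prime-reflected p-prime p≥5 n)
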